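{- Let $m\geqslant 2$ and $k\geqslant 2$. The shortest pair of distinct factors of $\mathbf{t}_m$ that are $k$-binomially equivalent have length $2m^{k-1}$. In particular, for every length $n<2m^{k-1}$, the $k$-binomial complexity $b^{(k)}_{\mathbf{t}_m}(n)$ coincides with the factor complexity $p_{\mathbf{t}_m}(n)$.
   Context: Let $\mathcal{A}_m=\{0,1,\ldots,m-1\}$, identified with $\mathbb{Z}/m\mathbb{Z}$ (all letter arithmetic is modulo $m$). Let $\sigma_m:\mathcal{A}_m^*\to\mathcal{A}_m^*$ be the morphism $\sigma_m(i)=i\,(i+1)\cdots(i+m-1)$, and let $\mathbf{t}_m=\lim_{j\to\infty}\sigma_m^j(0)$ be the generalized Thue--Morse word. A factor of a word is a block of consecutive letters; a subword is a (not necessarily contiguous) subsequence. For words $u,w$, the binomial coefficient $\binom{u}{w}$ is the number of occurrences of $w$ as a subword of $u$. Two words $u,v$ are $k$-binomially equivalent, $u\sim_k v$, if $\binom{u}{x}=\binom{v}{x}$ for all words $x$ of length at most $k$. The $k$-binomial complexity $b^{(k)}_{\mathbf{t}_m}(n)$ is the number of $\sim_k$-classes of the set of factors of length $n$ of $\mathbf{t}_m$, and $p_{\mathbf{t}_m}(n)$ is the number of factors of length $n$ of $\mathbf{t}_m$. -}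

module Defs where

open import Data.Nat using (ℕ; zero; suc; _+_; _*_; _^_; _≤_; _<_; _≡ᵇ_; _%_; NonZero)
open import Data.Bool using (if_then_else_)
open import Data.List using (List; []; _∷_; map; concatMap; upTo; length)
open import Data.List.Relation.Unary.All using (All)
open import Data.Product using (Σ; _×_; ∃)
open import Relation.Binary.PropositionalEquality using (_≡_)
open import Function using (_∘_)

-- Letters of 𝒜_m are the naturals 0 … m-1; letter arithmetic is modulo m.

σ : (m : ℕ) → .{{_ : NonZero m}} → ℕ → List ℕ
σ m i = map (λ j → (i + j) % m) (upTo m)

σ* : (m : ℕ) → .{{_ : NonZero m}} → List ℕ → List ℕ
σ* m = concatMap (σ m)

σ^[_] : ℕ → (m : ℕ) → .{{_ : NonZero m}} → List ℕ
σ^[ zero  ] m = 0 ∷ []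
σ^[ suc j ] m = σ* m (σ^[ j ] m)

-- n-th letter of a finite word (default 0 out of range; never used out of range below)
at : List ℕ → ℕ → ℕ
at []      _       = 0
at (a ∷ u) zero    = a
at (a ∷ u) (suc n) = at u n

-- t_m = lim σ_m^j(0): its n-th letter is the n-th letter of the prefix σ_m^{n+1}(0),
-- which has length m^{n+1} > n when m ≥ 2 (σ_m(0) begins with 0, so the
-- σ_m^j(0) are successive prefixes of the limit).
t : (m : ℕ) → .{{_ : NonZero m}} → ℕ → ℕ
t m n = at (σ^[ suc n ] m) n

factorAt : (m : ℕ) → .{{_ : NonZero m}} → ℕ → ℕ → List ℕ
factorAt m i n = map (λ j → t m (i + j)) (upTo n)

IsFactor : (m : ℕ) → .{{_ : NonZero m}} → List ℕ → Set
IsFactor m u = ∃ λ i → u ≡ factorAt m i (length u)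

binom : List ℕ → List ℕ → ℕ
binom u       []      = 1
binom []      (b ∷ w) = 0
binom (a ∷ u) (b ∷ w) = binom u (b ∷ w) + (if a ≡ᵇ b then binom u w else 0)

BinEq : (m k : ℕ) → List ℕ → List ℕ → Set
BinEq m k u v = (x : List ℕ) → All (_< m) x → length x ≤ k → binom u x ≡ binom v x

{-# OPTIONS --safe #-}
module Submission where

open import Defs
open import Data.Nat using (ℕ; zero; suc; pred; _+_; _*_; _^_; _∸_; _≤_; _<_; NonZero; >-nonZero; >-nonZero⁻¹; z≤n; s≤s; z<s; s<s; _≡ᵇ_; _/_; _%_)
open import Data.Nat.Properties
open import Data.Nat.DivMod
open import Data.Nat.Divisibility using (n∣m*n)
open import Data.Bool using (if_then_else_; true; false; T)
open import Data.Integer using (ℤ; 0ℤ; 1ℤ; -1ℤ; +_; -≤+; +≤+; -≤-) renaming (_+_ to _+ᶻ_; _*_ to _*ᶻ_; _-_ to _-ᶻ_; _≤_ to _≤ᶻ_; NonZero to NonZeroᶻ)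
import Data.Nat.Tactic.RingSolver as ℕ-Solver
import Data.Integer.Properties as ℤₚ
open import Data.Integer.Tactic.RingSolver using (solve-∀)
open import Data.List using (List; []; _∷_; _∷ʳ_; _++_; map; length; upTo; applyUpTo; concatMap)
open import Data.List.Properties using (length-++; length-map; length-upTo; length-applyUpTo; map-upTo; applyUpTo-∷ʳ; concatMap-++; concatMap-pure; ++-assoc)
open import Data.List.Relation.Unary.All using (All; []; _∷_)
open import Data.List.Relation.Unary.All.Properties using (++⁺)
open import Data.List.Relation.Binary.Permutation.Propositional using (_↭_; refl; prep; swap; ↭-trans; ↭-sym; ↭-reflexive)
import Data.List.Relation.Binary.Permutation.Propositional as ↭
open import Data.List.Relation.Binary.Permutation.Propositional.Properties using (∷↭∷ʳ)
open import Data.Product using (_×_; ∃; _,_; proj₁)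
open import Data.Sum using (_⊎_; inj₁; inj₂)
open import Data.Empty using (⊥; ⊥-elim)
open import Relation.Binary.PropositionalEquality using (_≡_; _≢_; refl; sym; trans; cong; cong₂; subst; subst₂; module ≡-Reasoning)
open import Function using (_∘_)
open import Relation.Nullary using (¬_; contradiction; yes; no)

open ≡-Reasoning

-- Upper bound: if u ∼_k v then uv ∼_{k+1} vu, so all words σ^K(a) are K-binomially equivalent, and
-- σ^K(ab) ∼_{K+1} σ^K(ba); both ab and ba occur in t_m for a = 1, b = 2.
--
-- Lower bound: from u ∼_k v only the moments Σ C(i,j) [u_i = a], j < k, are kept (sum over all words
-- y·a with |y| = j).  Write b_i for the letter whose image contains position i and
-- f_a(i) = [u_i = a] − [b_i = a].  Then [u_i = a] − [u_i = a−1] = f_a(i) − f_a(i+1), so summation by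
-- parts turns the moments of u − v into those of the block letters: with F the difference of the f's,
-- F_a(0) = F_a(n), and Σ ([b_i = a] − [b′_i = a]) = −n F_a(0).  As the left side is at most n in absolute
-- value, either u = v is a run h, h+1, …, or F vanishes at both ends, which forces u = pσ(x)s and
-- v = pσ(y)s with the same p and s.  The moments of x and y then agree for j < k−1, and induction applies.

-- Sums and binomial moments

S : ℕ → (ℕ → ℤ) → ℤ
S zero    f = 0ℤ
S (suc n) f = S n f +ᶻ f n

S-cong : ∀ n {f g : ℕ → ℤ} → (∀ i → i < n → f i ≡ g i) → S n f ≡ S n g
S-cong zero    eq = refl
S-cong (suc n) eq = cong₂ _+ᶻ_ (S-cong n (λ i i<n → eq i (m<n⇒m<1+n i<n))) (eq n (n<1+n n))

S-zero : ∀ n {f : ℕ → ℤ} → (∀ i → i < n → f i ≡ 0ℤ) → S n f ≡ 0ℤ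
S-zero zero    eq = refl
S-zero (suc n) eq = cong₂ _+ᶻ_ (S-zero n (λ i i<n → eq i (m<n⇒m<1+n i<n))) (eq n (n<1+n n))

interchange : ∀ a b c d → (a +ᶻ b) +ᶻ (c +ᶻ d) ≡ (a +ᶻ c) +ᶻ (b +ᶻ d)
interchange = solve-∀

S-+ : ∀ n (f g : ℕ → ℤ) → S n (λ i → f i +ᶻ g i) ≡ S n f +ᶻ S n g
S-+ zero    f g = refl
S-+ (suc n) f g = trans (cong (_+ᶻ (f n +ᶻ g n)) (S-+ n f g)) (interchange (S n f) (S n g) (f n) (g n))

S-* : ∀ n c (f : ℕ → ℤ) → S n (λ i → c *ᶻ f i) ≡ c *ᶻ S n f
S-* zero    c f = sym (ℤₚ.*-zeroʳ c)
S-* (suc n) c f = trans (cong (_+ᶻ c *ᶻ f n) (S-* n c f)) (sym (ℤₚ.*-distribˡ-+ c (S n f) (f n)))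

S-- : ∀ n (f g : ℕ → ℤ) → S n (λ i → f i -ᶻ g i) ≡ S n f -ᶻ S n g
S-- zero    f g = refl
S-- (suc n) f g = trans (cong (_+ᶻ (f n -ᶻ g n)) (S-- n f g)) (lem (S n f) (S n g) (f n) (g n))
  where
  lem : ∀ a b c d → (a -ᶻ b) +ᶻ (c -ᶻ d) ≡ (a +ᶻ c) -ᶻ (b +ᶻ d)
  lem = solve-∀

S-const : ∀ n c → S n (λ _ → c) ≡ + n *ᶻ c
S-const zero    c = sym (ℤₚ.*-zeroˡ c)
S-const (suc n) c = begin
  S n (λ _ → c) +ᶻ c  ≡⟨ cong (_+ᶻ c) (S-const n c) ⟩
  + n *ᶻ c +ᶻ c       ≡⟨ ℤₚ.+-comm _ c ⟩
  c +ᶻ + n *ᶻ c       ≡⟨ ℤₚ.suc-* (+ n) c ⟨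
  + suc n *ᶻ c        ∎

S-split : ∀ a b (f : ℕ → ℤ) → S (a + b) f ≡ S a f +ᶻ S b (λ i → f (a + i))
S-split a zero    f rewrite +-identityʳ a = sym (ℤₚ.+-identityʳ _)
S-split a (suc b) f rewrite +-suc a b =
  trans (cong (_+ᶻ f (a + b)) (S-split a b f)) (ℤₚ.+-assoc (S a f) _ _)

S-front : ∀ n (f : ℕ → ℤ) → S (suc n) f ≡ f 0 +ᶻ S n (λ i → f (suc i))
S-front n f = trans (S-split 1 n f) (cong (_+ᶻ S n (λ i → f (suc i))) (ℤₚ.+-identityˡ (f 0)))

S-blocks : ∀ m n (f : ℕ → ℤ) → S (n * m) f ≡ S n (λ i → S m (λ s → f (i * m + s)))
S-blocks m zero    f = refl
S-blocks m (suc n) f rewrite +-comm m (n * m) =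
  trans (S-split (n * m) m f) (cong (_+ᶻ S m (λ s → f (n * m + s))) (S-blocks m n f))

-- Binomial coefficients and summation by parts

C : ℕ → ℕ → ℤ
C n       zero    = 1ℤ
C zero    (suc j) = 0ℤ
C (suc n) (suc j) = C n j +ᶻ C n (suc j)

C-1 : ∀ n → C n 1 ≡ + n
C-1 zero    = refl
C-1 (suc n) = cong (1ℤ +ᶻ_) (C-1 n)

-- Used at `x = l + i * m`: passing from i to i + 1 in a dilated binomial coefficient moves its
-- argument across a block of length m.
hockey-stick : ∀ x m j → C (x + m) (suc j) -ᶻ C x (suc j) ≡ S m (λ r → C (x + r) j)
hockey-stick x zero    j rewrite +-identityʳ x = ℤₚ.+-inverseʳ (C x (suc j))
hockey-stick x (suc m) j rewrite +-suc x m = begin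
  (C (x + m) j +ᶻ C (x + m) (suc j)) -ᶻ C x (suc j)  ≡⟨ lem (C (x + m) j) (C (x + m) (suc j)) (C x (suc j)) ⟩
  (C (x + m) (suc j) -ᶻ C x (suc j)) +ᶻ C (x + m) j  ≡⟨ cong (_+ᶻ C (x + m) j) (hockey-stick x m j) ⟩
  S m (λ r → C (x + r) j) +ᶻ C (x + m) j             ∎
  where
  lem : ∀ a b c → (a +ᶻ b) -ᶻ c ≡ (b -ᶻ c) +ᶻ a
  lem = solve-∀

-- Summation by parts: the forward difference of `C i (suc j)` is `C i j`. There is no boundary term
-- at 0 because `C 0 (suc j)` is 0. The weight on the difference has one degree more, so each
-- desubstitution costs one order of moments.
abel : ∀ n j (F : ℕ → ℤ) →
  S n (λ i → C i (suc j) *ᶻ (F i -ᶻ F (suc i))) +ᶻ C n (suc j) *ᶻ F n ≡ S n (λ i → C i j *ᶻ F (suc i))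
abel zero    j F = refl
abel (suc n) j F = trans (lem (S n _) (C n j) (C n (suc j)) (F n) (F (suc n))) (cong (_+ᶻ C n j *ᶻ F (suc n)) (abel n j F))
  where
  lem : ∀ s a b x y → (s +ᶻ b *ᶻ (x -ᶻ y)) +ᶻ (a +ᶻ b) *ᶻ y ≡ (s +ᶻ b *ᶻ x) +ᶻ a *ᶻ y
  lem = solve-∀

telescope : ∀ n (F : ℕ → ℤ) → S n (λ i → F i -ᶻ F (suc i)) ≡ F 0 -ᶻ F n
telescope zero    F = sym (ℤₚ.+-inverseʳ (F 0))
telescope (suc n) F = trans (cong (_+ᶻ (F n -ᶻ F (suc n))) (telescope n F)) (lem (F 0) (F n) (F (suc n)))
  where
  lem : ∀ a b c → (a -ᶻ b) +ᶻ (b -ᶻ c) ≡ a -ᶻ c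
  lem = solve-∀

-- Integer-valued polynomials of degree < K, expanded in the binomial basis.
Pol : ℕ → (ℕ → ℤ) → Set
Pol zero    p = ∀ i → p i ≡ 0ℤ
Pol (suc K) p = ∃ λ c → Pol K (λ i → p i -ᶻ c *ᶻ C i K)

Pol-cong : ∀ K {p q : ℕ → ℤ} → (∀ i → p i ≡ q i) → Pol K p → Pol K q
Pol-cong zero    eq P       i = trans (sym (eq i)) (P i)
Pol-cong (suc K) eq (c , P) = c , Pol-cong K (λ i → cong (_-ᶻ c *ᶻ C i K) (eq i)) P

Pol-0 : ∀ K → Pol K (λ _ → 0ℤ)
Pol-0 zero    i = refl
Pol-0 (suc K) = 0ℤ , Pol-cong K (λ i → sym (cong (0ℤ -ᶻ_) (ℤₚ.*-zeroˡ (C i K)))) (Pol-0 K)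

Pol-+ : ∀ K {p q : ℕ → ℤ} → Pol K p → Pol K q → Pol K (λ i → p i +ᶻ q i)
Pol-+ zero    P Q i = cong₂ _+ᶻ_ (P i) (Q i)
Pol-+ (suc K) {p} {q} (c , P) (d , Q) =
  c +ᶻ d , Pol-cong K (λ i → lem (p i) (q i) c d (C i K)) (Pol-+ K P Q)
  where
  lem : ∀ x y c d z → (x -ᶻ c *ᶻ z) +ᶻ (y -ᶻ d *ᶻ z) ≡ (x +ᶻ y) -ᶻ (c +ᶻ d) *ᶻ z
  lem = solve-∀

Pol-S : ∀ K n {p : ℕ → ℕ → ℤ} → (∀ s → Pol K (p s)) → Pol K (λ i → S n (λ s → p s i))
Pol-S K zero    P = Pol-0 K
Pol-S K (suc n) P = Pol-+ K (Pol-S K n P) (P n)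

-- Discrete antiderivative: the difference of `C i (suc K)` is `C i K`, so the coefficients carry
-- over with degrees raised by one, and the new constant term is `p 0`.
Pol-integrate : ∀ K {p : ℕ → ℤ} → Pol K (λ i → p (suc i) -ᶻ p i) → Pol (suc K) p
Pol-integrate zero {p} P = p 0 , λ i → trans (cong (_-ᶻ p 0 *ᶻ 1ℤ) (const i)) (lem (p 0))
  where
  lem : ∀ x → x -ᶻ x *ᶻ 1ℤ ≡ 0ℤ
  lem = solve-∀
  const : ∀ i → p i ≡ p 0
  const zero    = refl
  const (suc i) = trans (ℤₚ.i-j≡0⇒i≡j _ _ (P i)) (const i)
Pol-integrate (suc K) {p} (c , P) =
  c , Pol-integrate K {λ i → p i -ᶻ c *ᶻ C i (suc K)} (Pol-cong K (λ i → lem (p (suc i)) (p i) c (C i K) (C i (suc K))) P)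
  where
  lem : ∀ x y c z w → (x -ᶻ y) -ᶻ c *ᶻ z ≡ (x -ᶻ c *ᶻ (z +ᶻ w)) -ᶻ (y -ᶻ c *ᶻ w)
  lem = solve-∀

-- As a polynomial in i, `C (l + i * m) j` has leading term `m ^ j` times `C i j`. By the
-- hockey-stick identity its difference in i is a sum of m terms of degree one less, which
-- multiplies the leading coefficient by m. These terms have shifts `l + r`, hence the induction for
-- all l.
Pol-dilate : ∀ m j l → Pol j (λ i → C (l + i * m) j -ᶻ + (m ^ j) *ᶻ C i j)
Pol-dilate m zero    l i = refl
Pol-dilate m (suc j) l = Pol-integrate j {λ i → C (l + i * m) (suc j) -ᶻ + (m ^ suc j) *ᶻ C i (suc j)} (Pol-cong j difference (Pol-S j m (λ r → Pol-dilate m j (l + r))))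
  where
  lem : ∀ x y m c z w → (x -ᶻ y) -ᶻ m *ᶻ (c *ᶻ z) ≡ (x -ᶻ (m *ᶻ c) *ᶻ (z +ᶻ w)) -ᶻ (y -ᶻ (m *ᶻ c) *ᶻ w)
  lem = solve-∀
  difference : ∀ i → S m (λ r → C (l + r + i * m) j -ᶻ + (m ^ j) *ᶻ C i j) ≡
    (C (l + suc i * m) (suc j) -ᶻ + (m ^ suc j) *ᶻ C (suc i) (suc j)) -ᶻ (C (l + i * m) (suc j) -ᶻ + (m ^ suc j) *ᶻ C i (suc j))
  difference i = begin
    S m (λ r → C (l + r + i * m) j -ᶻ + (m ^ j) *ᶻ C i j)
      ≡⟨ S-- m _ _ ⟩
    S m (λ r → C (l + r + i * m) j) -ᶻ S m (λ _ → + (m ^ j) *ᶻ C i j)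
      ≡⟨ cong₂ _-ᶻ_ (S-cong m (λ r _ → cong (λ x → C x j) (swapʳ r))) (S-const m _) ⟩
    S m (λ r → C (l + i * m + r) j) -ᶻ + m *ᶻ (+ (m ^ j) *ᶻ C i j)
      ≡⟨ cong (_-ᶻ _) (hockey-stick (l + i * m) m j) ⟨
    (C (l + i * m + m) (suc j) -ᶻ C (l + i * m) (suc j)) -ᶻ + m *ᶻ (+ (m ^ j) *ᶻ C i j)
      ≡⟨ cong (λ x → (C x (suc j) -ᶻ C (l + i * m) (suc j)) -ᶻ + m *ᶻ (+ (m ^ j) *ᶻ C i j)) (trans (+-assoc l (i * m) m) (cong (λ x → l + x) (+-comm (i * m) m))) ⟩
    (C (l + suc i * m) (suc j) -ᶻ C (l + i * m) (suc j)) -ᶻ + m *ᶻ (+ (m ^ j) *ᶻ C i j)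
      ≡⟨ lem (C (l + suc i * m) (suc j)) (C (l + i * m) (suc j)) (+ m) (+ (m ^ j)) (C i j) (C i (suc j)) ⟩
    (C (l + suc i * m) (suc j) -ᶻ (+ m *ᶻ + (m ^ j)) *ᶻ C (suc i) (suc j)) -ᶻ (C (l + i * m) (suc j) -ᶻ (+ m *ᶻ + (m ^ j)) *ᶻ C i (suc j))
      ≡⟨ cong (λ c → (C (l + suc i * m) (suc j) -ᶻ c *ᶻ C (suc i) (suc j)) -ᶻ (C (l + i * m) (suc j) -ᶻ c *ᶻ C i (suc j))) (ℤₚ.pos-* m (m ^ j)) ⟨
    (C (l + suc i * m) (suc j) -ᶻ + (m ^ suc j) *ᶻ C (suc i) (suc j)) -ᶻ (C (l + i * m) (suc j) -ᶻ + (m ^ suc j) *ᶻ C i (suc j)) ∎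
    where
    swapʳ : ∀ r → l + r + i * m ≡ l + i * m + r
    swapʳ r = trans (+-assoc l r _) (trans (cong (λ x → l + x) (+-comm r _)) (sym (+-assoc l _ r)))

Orth : ℕ → ℕ → (ℕ → ℤ) → Set
Orth n k f = ∀ j → j < k → S n (λ i → C i j *ᶻ f i) ≡ 0ℤ

Orth-Pol : ∀ n K {p f : ℕ → ℤ} → Orth n K f → Pol K p → S n (λ i → p i *ᶻ f i) ≡ 0ℤ
Orth-Pol n zero    {f = f} O P = S-zero n (λ i _ → trans (cong (_*ᶻ f i) (P i)) (ℤₚ.*-zeroˡ (f i)))
Orth-Pol n (suc K) {p} {f} O (c , P) = begin
  S n (λ i → p i *ᶻ f i)
    ≡⟨ S-cong n (λ i _ → lem (p i) c (C i K) (f i)) ⟩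
  S n (λ i → (p i -ᶻ c *ᶻ C i K) *ᶻ f i +ᶻ c *ᶻ (C i K *ᶻ f i))
    ≡⟨ S-+ n _ _ ⟩
  S n (λ i → (p i -ᶻ c *ᶻ C i K) *ᶻ f i) +ᶻ S n (λ i → c *ᶻ (C i K *ᶻ f i))
    ≡⟨ cong₂ _+ᶻ_ (Orth-Pol n K (λ j j<K → O j (m<n⇒m<1+n j<K)) P) (S-* n c _) ⟩
  0ℤ +ᶻ c *ᶻ S n (λ i → C i K *ᶻ f i)
    ≡⟨ cong (λ x → 0ℤ +ᶻ c *ᶻ x) (O K (n<1+n K)) ⟩
  0ℤ +ᶻ c *ᶻ 0ℤ
    ≡⟨ cong (0ℤ +ᶻ_) (ℤₚ.*-zeroʳ c) ⟩
  0ℤ ∎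
  where
  lem : ∀ x c z y → x *ᶻ y ≡ (x -ᶻ c *ᶻ z) *ᶻ y +ᶻ c *ᶻ (z *ᶻ y)
  lem = solve-∀

-- Up to lower degree, summing C (l + ·) j over a block of length m rescales C · j by m ^ suc j.
Orth-unstretch : ∀ m .{{_ : NonZero m}} l n K {f g : ℕ → ℤ} →
  (∀ i s → i < n → s < m → g (i * m + s) ≡ f i) →
  (∀ j → j < K → S (n * m) (λ x → C (l + x) j *ᶻ g x) ≡ 0ℤ) → Orth n K f
Orth-unstretch m l n zero            eq O j ()
Orth-unstretch m l n (suc K) {f} {g} eq O j j<1+K with m<1+n⇒m<n∨m≡n j<1+K
... | inj₁ j<K  = Orth-unstretch m l n K eq (λ j j<K → O j (m<n⇒m<1+n j<K)) j j<K
... | inj₂ refl = ℤₚ.*-cancelˡ-≡ (+ m *ᶻ + (m ^ K)) _ _ {{nz}} (begin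
  (+ m *ᶻ + (m ^ K)) *ᶻ S n (λ i → C i K *ᶻ f i)
    ≡⟨ S-* n (+ m *ᶻ + (m ^ K)) (λ i → C i K *ᶻ f i) ⟨
  S n (λ i → (+ m *ᶻ + (m ^ K)) *ᶻ (C i K *ᶻ f i))
    ≡⟨ S-cong n (λ i i<n → weights i i<n) ⟩
  S n (λ i → S m (λ s → C (l + (i * m + s)) K *ᶻ g (i * m + s)) -ᶻ q i *ᶻ f i)
    ≡⟨ S-- n _ _ ⟩
  S n (λ i → S m (λ s → C (l + (i * m + s)) K *ᶻ g (i * m + s))) -ᶻ S n (λ i → q i *ᶻ f i)
    -- The first sum vanishes by the hypothesis at order K. The correction `q` has degree below K,
    -- so the lower moments of f, already known to vanish, kill it.
    ≡⟨ cong₂ _-ᶻ_ (trans (sym (S-blocks m n _)) (O K (n<1+n K))) (Orth-Pol n K lower q-Pol) ⟩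
  0ℤ
    ≡⟨ ℤₚ.*-zeroʳ (+ m *ᶻ + (m ^ K)) ⟨
  (+ m *ᶻ + (m ^ K)) *ᶻ 0ℤ ∎)
  where
  nz = subst NonZeroᶻ (ℤₚ.pos-* m (m ^ K)) (m^n≢0 m (suc K))
  lower : Orth n K f
  lower = Orth-unstretch m l n K eq (λ j j<K → O j (m<n⇒m<1+n j<K))
  q : ℕ → ℤ
  q i = S m (λ s → C (l + s + i * m) K -ᶻ + (m ^ K) *ᶻ C i K)
  q-Pol : Pol K q
  q-Pol = Pol-S K m (λ s → Pol-dilate m K (l + s))
  lem : ∀ m c z y x → (m *ᶻ c) *ᶻ (z *ᶻ y) ≡ y *ᶻ x -ᶻ (x -ᶻ m *ᶻ (c *ᶻ z)) *ᶻ y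
  lem = solve-∀
  weights : ∀ i → i < n → (+ m *ᶻ + (m ^ K)) *ᶻ (C i K *ᶻ f i) ≡
    S m (λ s → C (l + (i * m + s)) K *ᶻ g (i * m + s)) -ᶻ q i *ᶻ f i
  weights i i<n = begin
    (+ m *ᶻ + (m ^ K)) *ᶻ (C i K *ᶻ f i)
      ≡⟨ lem (+ m) (+ (m ^ K)) (C i K) (f i) (S m (λ s → C (l + s + i * m) K)) ⟩
    f i *ᶻ S m (λ s → C (l + s + i * m) K) -ᶻ (S m (λ s → C (l + s + i * m) K) -ᶻ + m *ᶻ (+ (m ^ K) *ᶻ C i K)) *ᶻ f i
      ≡⟨ cong₂ (λ x y → x -ᶻ y *ᶻ f i)
           (sym (trans (S-cong m (λ s s<m → trans (cong₂ _*ᶻ_ (cong (λ x → C x K) (rot s)) (eq i s i<n s<m)) (ℤₚ.*-comm (C (l + s + i * m) K) (f i))))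
             (S-* m (f i) (λ s → C (l + s + i * m) K))))
           (sym (trans (S-- m (λ s → C (l + s + i * m) K) (λ _ → + (m ^ K) *ᶻ C i K))
             (cong (S m (λ s → C (l + s + i * m) K) -ᶻ_) (S-const m (+ (m ^ K) *ᶻ C i K))))) ⟩
    S m (λ s → C (l + (i * m + s)) K *ᶻ g (i * m + s)) -ᶻ q i *ᶻ f i ∎
    where
    rot : ∀ s → l + (i * m + s) ≡ l + s + i * m
    rot s = trans (cong (λ x → l + x) (+-comm (i * m) s)) (sym (+-assoc l s _))

-- Words and residues

at-++ˡ : ∀ u v i → i < length u → at (u ++ v) i ≡ at u i
at-++ˡ (a ∷ u) v zero    i<      = refl
at-++ˡ (a ∷ u) v (suc i) (s<s i<) = at-++ˡ u v i i<

at-++ʳ : ∀ u v i → at (u ++ v) (length u + i) ≡ at v i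
at-++ʳ []      v i = refl
at-++ʳ (a ∷ u) v i = at-++ʳ u v i

at-map-applyUpTo : ∀ (f g : ℕ → ℕ) n i → i < n → at (map f (applyUpTo g n)) i ≡ f (g i)
at-map-applyUpTo f g (suc n) zero    i<      = refl
at-map-applyUpTo f g (suc n) (suc i) (s<s i<) = at-map-applyUpTo f (λ j → g (suc j)) n i i<

module _ (m : ℕ) .{{_ : NonZero m}} where

  %-+ˡ : ∀ a b → (a % m + b) % m ≡ (a + b) % m
  %-+ˡ a b = begin
    (a % m + b) % m            ≡⟨ %-distribˡ-+ (a % m) b m ⟩
    (a % m % m + b % m) % m    ≡⟨ cong (λ x → (x + b % m) % m) (m%n%n≡m%n a m) ⟩
    (a % m + b % m) % m        ≡⟨ %-distribˡ-+ a b m ⟨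
    (a + b) % m                ∎

  %-cancelˡ-+ : ∀ a {b c} → b < m → c < m → (a + b) % m ≡ (a + c) % m → b ≡ c
  %-cancelˡ-+ a {b} {c} b<m c<m eq = begin
    b                                    ≡⟨ shift b b<m ⟩
    ((a + b) % m + a * pred m) % m       ≡⟨ cong (λ x → (x + a * pred m) % m) eq ⟩
    ((a + c) % m + a * pred m) % m       ≡⟨ shift c c<m ⟨
    c                                    ∎
    where
    -- `a * pred m` acts as the negative of a modulo m, since the two add up to `a * m`.
    shift : ∀ b → b < m → b ≡ ((a + b) % m + a * pred m) % m
    shift b b<m = begin
      b                                ≡⟨ m<n⇒m%n≡m b<m ⟨
      b % m                            ≡⟨ [m+kn]%n≡m%n b a m ⟨
      (b + a * m) % m                  ≡⟨ cong (λ x → (b + a * x) % m) (suc-pred m) ⟨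
      (b + a * suc (pred m)) % m       ≡⟨ cong (λ x → (b + x) % m) (*-suc a (pred m)) ⟩
      (b + (a + a * pred m)) % m       ≡⟨ cong (_% m) (trans (sym (+-assoc b a _)) (cong (_+ a * pred m) (+-comm b a))) ⟩
      (a + b + a * pred m) % m         ≡⟨ %-+ˡ (a + b) (a * pred m) ⟨
      ((a + b) % m + a * pred m) % m   ∎

  [r+q*m]/m≡q : ∀ {r} q → r < m → (r + q * m) / m ≡ q
  [r+q*m]/m≡q {r} q r<m = begin
    (r + q * m) / m      ≡⟨ +-distrib-/-∣ʳ r (n∣m*n q) ⟩
    r / m + q * m / m    ≡⟨ cong₂ _+_ (m<n⇒m/n≡0 r<m) (m*n/n≡m q m) ⟩
    q                    ∎

-- Letter indicators and extremal sums

δ : ℕ → ℕ → ℤ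
δ x a = if x ≡ᵇ a then 1ℤ else 0ℤ

δ-refl : ∀ a → δ a a ≡ 1ℤ
δ-refl zero    = refl
δ-refl (suc a) = δ-refl a

δ-≢ : ∀ {x a} → x ≢ a → δ x a ≡ 0ℤ
δ-≢ {x} {a} x≢a with x ≡ᵇ a in eq
... | true  = contradiction (≡ᵇ⇒≡ x a (subst T (sym eq) _)) x≢a
... | false = refl

δ-0∨1 : ∀ x a → (x ≡ a × δ x a ≡ 1ℤ) ⊎ (x ≢ a × δ x a ≡ 0ℤ)
δ-0∨1 x a with x ≟ a
... | yes refl = inj₁ (refl , δ-refl a)
... | no x≢a   = inj₂ (x≢a , δ-≢ x≢a)

δ-≥0 : ∀ x a → 0ℤ ≤ᶻ δ x a
δ-≥0 x a with δ-0∨1 x a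
... | inj₁ (_ , eq) rewrite eq = +≤+ z≤n
... | inj₂ (_ , eq) rewrite eq = +≤+ z≤n

δ-injective : ∀ {x y} → δ x x ≡ δ y x → x ≡ y
δ-injective {x} {y} eq with δ-0∨1 y x
... | inj₁ (y≡x , _) = sym y≡x
... | inj₂ (_ , eq′) with () ← trans (sym (δ-refl x)) (trans eq eq′)

δ-δ≤1 : ∀ x y a → δ x a -ᶻ δ y a ≤ᶻ 1ℤ
δ-δ≤1 x y a with δ-0∨1 x a | δ-0∨1 y a
... | inj₁ (_ , eq) | inj₁ (_ , eq′) rewrite eq | eq′ = +≤+ z≤n
... | inj₁ (_ , eq) | inj₂ (_ , eq′) rewrite eq | eq′ = ℤₚ.≤-refl
... | inj₂ (_ , eq) | inj₁ (_ , eq′) rewrite eq | eq′ = -≤+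
... | inj₂ (_ , eq) | inj₂ (_ , eq′) rewrite eq | eq′ = +≤+ z≤n

δ-δ≡1 : ∀ x y a → δ x a -ᶻ δ y a ≡ 1ℤ → x ≡ a
δ-δ≡1 x y a e with δ-0∨1 x a | δ-0∨1 y a
... | inj₁ (x≡a , _) | _ = x≡a
... | inj₂ (_ , eq) | inj₁ (_ , eq′) rewrite eq | eq′ with () ← e
... | inj₂ (_ , eq) | inj₂ (_ , eq′) rewrite eq | eq′ with () ← e

S-≤ : ∀ n {f : ℕ → ℤ} → (∀ i → i < n → f i ≤ᶻ 1ℤ) → S n f ≤ᶻ + n
S-≤ zero    f≤1 = ℤₚ.≤-refl
S-≤ (suc n) {f} f≤1 = subst (S n f +ᶻ f n ≤ᶻ_) (cong +_ (+-comm n 1))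
  (ℤₚ.+-mono-≤ (S-≤ n (λ i i<n → f≤1 i (m<n⇒m<1+n i<n))) (f≤1 n (n<1+n n)))

-- `S n f` and `f n` are each bounded above, by n and by 1, so a total of n + 1 forces both to their
-- bounds. In `extremal` this turns one identity between sums into information at every position.
S-extremal : ∀ n {f : ℕ → ℤ} → (∀ i → i < n → f i ≤ᶻ 1ℤ) → + n ≤ᶻ S n f → ∀ i → i < n → f i ≡ 1ℤ
S-extremal (suc n) {f} f≤1 n≤S i i<1+n with m<1+n⇒m<n∨m≡n i<1+n
... | inj₁ i<n  = S-extremal n (λ i i<n → f≤1 i (m<n⇒m<1+n i<n))
  (subst₂ _≤ᶻ_ (cancel (+ n) 1ℤ) (cancel (S n f) (f n)) (ℤₚ.+-mono-≤ (subst (_≤ᶻ S n f +ᶻ f n) (cong +_ (+-comm 1 n)) n≤S) (ℤₚ.neg-mono-≤ (f≤1 n (n<1+n n))))) i i<n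
  where
  cancel : ∀ x y → (x +ᶻ y) -ᶻ y ≡ x
  cancel = solve-∀
... | inj₂ refl = ℤₚ.≤-antisym (f≤1 n i<1+n)
  (subst₂ _≤ᶻ_ (cancel (+ n) 1ℤ) (cancel (S n f) (f n)) (ℤₚ.+-mono-≤ (subst (_≤ᶻ S n f +ᶻ f n) (cong +_ (+-comm 1 n)) n≤S) (ℤₚ.neg-mono-≤ (S-≤ n (λ i i<n → f≤1 i (m<n⇒m<1+n i<n))))))
  where
  cancel : ∀ x y → (x +ᶻ y) -ᶻ x ≡ y
  cancel = solve-∀

-- Factors are determined by their moments

-- The lower bound rests on this digit recursion alone: it is the fixed-point equation of σ, read
-- position by position.
module DigitWord (m : ℕ) .{{_ : NonZero m}} (τ : ℕ → ℕ) (τ≡blk+offset : ∀ x → τ x ≡ (τ (x / m) + x % m) % m) where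

  τ<m : ∀ x → τ x < m
  τ<m x = subst (_< m) (sym (τ≡blk+offset x)) (m%n<n _ m)

  τ-digit : ∀ {r} q → r < m → τ (r + q * m) ≡ (τ q + r) % m
  τ-digit {r} q r<m = trans (τ≡blk+offset (r + q * m))
    (cong₂ (λ x y → (τ x + y) % m) ([r+q*m]/m≡q m q r<m) (trans ([m+kn]%n≡m%n r q m) (m<n⇒m%n≡m r<m)))

  -- The letter whose image under σ covers position x, written b in the overview.
  blk : ℕ → ℕ
  blk x = τ (x / m)

  next : ℕ → ℕ
  next a = suc a % m

  -- The witness is a - 1 modulo m. Identities below are proved at `next a`, and this transfers them
  -- to every letter.
  next-surjective : ∀ {a} → a < m → ∃ λ b → b < m × a ≡ next b
  next-surjective {a} a<m = (a + pred m) % m , m%n<n _ m , sym (begin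
    suc ((a + pred m) % m) % m  ≡⟨ cong (_% m) (+-comm 1 ((a + pred m) % m)) ⟩
    ((a + pred m) % m + 1) % m  ≡⟨ %-+ˡ m (a + pred m) 1 ⟩
    (a + pred m + 1) % m        ≡⟨ cong (_% m) (trans (+-assoc a (pred m) 1) (cong (λ x → a + x) (trans (+-comm (pred m) 1) (suc-pred m)))) ⟩
    (a + m) % m                 ≡⟨ [m+n]%n≡m%n a m ⟩
    a % m                       ≡⟨ m<n⇒m%n≡m a<m ⟩
    a                           ∎)

  δ-next : ∀ {x a} → x < m → a < m → δ (next x) (next a) ≡ δ x a
  δ-next {x} {a} x<m a<m with δ-0∨1 x a
  ... | inj₁ (refl , eq) = trans (δ-refl (next x)) (sym eq)
  ... | inj₂ (x≢a , eq)  = trans (δ-≢ (λ e → x≢a (%-cancelˡ-+ m 1 x<m a<m e))) (sym eq)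

  next-% : ∀ a → next (a % m) ≡ suc a % m
  next-% a = trans (cong (_% m) (+-comm 1 (a % m))) (trans (%-+ˡ m a 1) (cong (_% m) (+-comm a 1)))

  -- Inside a block the letter advances by one. When `x % m` is m - 1, position `suc x` opens a new
  -- block with that block's own letter, while the last letter of the old block is its block letter
  -- minus one.
  t-step : ∀ x → (blk (suc x) ≡ blk x × τ (suc x) ≡ next (τ x)) ⊎ (τ (suc x) ≡ blk (suc x) × next (τ x) ≡ blk x)
  t-step x with m≤n⇒m<n∨m≡n (m%n<n x m)
  ... | inj₁ r+1<m = inj₁ (cong τ quotient , (begin
    τ (suc x)                             ≡⟨ cong τ suc-x ⟩
    τ (suc (x % m) + (x / m) * m)         ≡⟨ τ-digit (x / m) r+1<m ⟩
    (blk x + suc (x % m)) % m             ≡⟨ cong (_% m) (+-suc (blk x) (x % m)) ⟩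
    suc (blk x + x % m) % m               ≡⟨ next-% (blk x + x % m) ⟨
    next ((blk x + x % m) % m)            ≡⟨ cong next (τ≡blk+offset x) ⟨
    next (τ x)                            ∎))
    where
    suc-x : suc x ≡ suc (x % m) + (x / m) * m
    suc-x = cong suc (m≡m%n+[m/n]*n x m)
    quotient : suc x / m ≡ x / m
    quotient = trans (cong (_/ m) suc-x) ([r+q*m]/m≡q m (x / m) r+1<m)
  ... | inj₂ r+1≡m = inj₂ ((begin
    τ (suc x)                        ≡⟨ τ≡blk+offset (suc x) ⟩
    (blk (suc x) + suc x % m) % m    ≡⟨ cong (λ y → (blk (suc x) + y) % m) remainder ⟩
    (blk (suc x) + 0) % m            ≡⟨ cong (_% m) (+-identityʳ _) ⟩
    blk (suc x) % m                  ≡⟨ m<n⇒m%n≡m (τ<m (suc x / m)) ⟩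
    blk (suc x)                      ∎) , (begin
    next (τ x)                       ≡⟨ cong next (τ≡blk+offset x) ⟩
    next ((blk x + x % m) % m)       ≡⟨ next-% (blk x + x % m) ⟩
    suc (blk x + x % m) % m          ≡⟨ cong (_% m) (trans (sym (+-suc (blk x) (x % m))) (cong (λ y → blk x + y) r+1≡m)) ⟩
    (blk x + m) % m                  ≡⟨ [m+n]%n≡m%n (blk x) m ⟩
    blk x % m                        ≡⟨ m<n⇒m%n≡m (τ<m (x / m)) ⟩
    blk x                            ∎))
    where
    remainder : suc x % m ≡ 0
    remainder = trans (cong (_% m) (trans (cong suc (m≡m%n+[m/n]*n x m)) (cong (_+ (x / m) * m) r+1≡m))) (m*n%n≡0 (suc (x / m)) m)

  -- The function f of the overview. It vanishes at the start of a block, where `τ x` equals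
  -- `blk x`.
  excess : ℕ → ℕ → ℤ
  excess a x = δ (τ x) a -ᶻ δ (blk x) a

  -- At a block boundary both sides vanish, since the last letter of a block is followed cyclically by its first.
  excess-step : ∀ {a} x → a < m → excess (next a) (suc x) ≡ δ (τ x) a -ᶻ δ (blk x) (next a)
  excess-step {a} x a<m with t-step x
  ... | inj₁ (same , step) = cong₂ _-ᶻ_
    (trans (cong (λ y → δ y (next a)) step) (δ-next (τ<m x) a<m)) (cong (λ y → δ y (next a)) same)
  ... | inj₂ (start , end) = begin
    δ (τ (suc x)) (next a) -ᶻ δ (blk (suc x)) (next a)  ≡⟨ cong (λ y → δ y (next a) -ᶻ δ (blk (suc x)) (next a)) start ⟩
    δ (blk (suc x)) (next a) -ᶻ δ (blk (suc x)) (next a) ≡⟨ ℤₚ.+-inverseʳ (δ (blk (suc x)) (next a)) ⟩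
    0ℤ                                                  ≡⟨ ℤₚ.+-inverseʳ (δ (τ x) a) ⟨
    δ (τ x) a -ᶻ δ (τ x) a                              ≡⟨ cong (δ (τ x) a -ᶻ_) (trans (sym (δ-next (τ<m x) a<m)) (cong (λ y → δ y (next a)) end)) ⟩
    δ (τ x) a -ᶻ δ (blk x) (next a)                     ∎

  -- Comparing two factors through their moments

  D : ℕ → ℕ → ℕ → ℕ → ℤ
  D A B a i = δ (τ (A + i)) a -ᶻ δ (τ (B + i)) a

  Dblk : ℕ → ℕ → ℕ → ℕ → ℤ
  Dblk A B a i = δ (blk (A + i)) a -ᶻ δ (blk (B + i)) a

  Moments : ℕ → ℕ → ℕ → ℕ → Set
  Moments k n A B = ∀ a → a < m → Orth n k (D A B a)

  Moments-sym : ∀ k n A B → Moments k n A B → Moments k n B A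
  Moments-sym k n A B O a a<m j j<k = begin
    S n (λ i → C i j *ᶻ D B A a i)
      ≡⟨ S-cong n (λ i _ → lem (C i j) (δ (τ (A + i)) a) (δ (τ (B + i)) a)) ⟩
    S n (λ i → -1ℤ *ᶻ (C i j *ᶻ D A B a i))
      ≡⟨ S-* n -1ℤ (λ i → C i j *ᶻ D A B a i) ⟩
    -1ℤ *ᶻ S n (λ i → C i j *ᶻ D A B a i)
      ≡⟨ cong (-1ℤ *ᶻ_) (O a a<m j j<k) ⟩
    0ℤ ∎
    where
    lem : ∀ c x y → c *ᶻ (y -ᶻ x) ≡ -1ℤ *ᶻ (c *ᶻ (x -ᶻ y))
    lem = solve-∀

  module Telescoping (K n A B : ℕ) (O : Moments (suc (suc K)) n A B) where

    F : ℕ → ℕ → ℤ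
    F a i = excess a (A + i) -ᶻ excess a (B + i)

    F-step : ∀ {a} i → a < m → F (next a) (suc i) ≡ D A B a i -ᶻ Dblk A B (next a) i
    F-step {a} i a<m rewrite +-suc A i | +-suc B i =
      trans (cong₂ _-ᶻ_ (excess-step (A + i) a<m) (excess-step (B + i) a<m))
        (lem (δ (τ (A + i)) a) (δ (blk (A + i)) (next a)) (δ (τ (B + i)) a) (δ (blk (B + i)) (next a)))
      where
      lem : ∀ x y z w → (x -ᶻ y) -ᶻ (z -ᶻ w) ≡ (x -ᶻ z) -ᶻ (y -ᶻ w)
      lem = solve-∀

    -- Both values of `F (next a)` contain the same term `Dblk A B (next a) i`. It cancels, leaving
    -- only letters of the two factors, whose moments are known to agree.
    F-difference : ∀ {a} i → a < m → F (next a) i -ᶻ F (next a) (suc i) ≡ D A B (next a) i -ᶻ D A B a i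
    F-difference {a} i a<m = trans (cong (F (next a) i -ᶻ_) (F-step i a<m))
      (lem (δ (τ (A + i)) (next a)) (δ (blk (A + i)) (next a)) (δ (τ (B + i)) (next a)) (δ (blk (B + i)) (next a)) (D A B a i))
      where
      lem : ∀ x y z w d → ((x -ᶻ y) -ᶻ (z -ᶻ w)) -ᶻ (d -ᶻ (y -ᶻ w)) ≡ (x -ᶻ z) -ᶻ d
      lem = solve-∀

    S-F-difference : ∀ {a} j → a < m → j < suc (suc K) → S n (λ i → C i j *ᶻ (F (next a) i -ᶻ F (next a) (suc i))) ≡ 0ℤ
    S-F-difference {a} j a<m j< = begin
      S n (λ i → C i j *ᶻ (F (next a) i -ᶻ F (next a) (suc i)))
        ≡⟨ S-cong n (λ i _ → trans (cong (C i j *ᶻ_) (F-difference i a<m)) (lem (C i j) (D A B (next a) i) (D A B a i))) ⟩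
      S n (λ i → C i j *ᶻ D A B (next a) i -ᶻ C i j *ᶻ D A B a i)
        ≡⟨ S-- n (λ i → C i j *ᶻ D A B (next a) i) (λ i → C i j *ᶻ D A B a i) ⟩
      S n (λ i → C i j *ᶻ D A B (next a) i) -ᶻ S n (λ i → C i j *ᶻ D A B a i)
        ≡⟨ cong₂ _-ᶻ_ (O (next a) (m%n<n _ m) j j<) (O a a<m j j<) ⟩
      0ℤ ∎
      where
      lem : ∀ c x y → c *ᶻ (x -ᶻ y) ≡ c *ᶻ x -ᶻ c *ᶻ y
      lem = solve-∀

    -- The order-0 moment of the differences of F is zero, and it telescopes.
    F-ends : ∀ {a} → a < m → F a 0 ≡ F a n
    F-ends a<m with b , b<m , refl ← next-surjective a<m = ℤₚ.i-j≡0⇒i≡j _ _ (begin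
      F (next b) 0 -ᶻ F (next b) n
        ≡⟨ telescope n (F (next b)) ⟨
      S n (λ i → F (next b) i -ᶻ F (next b) (suc i))
        ≡⟨ S-cong n (λ i _ → ℤₚ.*-identityˡ (F (next b) i -ᶻ F (next b) (suc i))) ⟨
      S n (λ i → 1ℤ *ᶻ (F (next b) i -ᶻ F (next b) (suc i)))
        ≡⟨ S-F-difference 0 b<m z<s ⟩
      0ℤ ∎)

    -- By `F-step` the block difference is a letter difference minus a shifted F. The first has zero
    -- moments; `abel` turns the second into a moment of order j + 1 of the differences of F, also
    -- zero, plus the boundary term at n.
    Dblk-moment : ∀ {a} j → a < m → j < suc K → S n (λ i → C i j *ᶻ Dblk A B a i) ≡ -1ℤ *ᶻ (C n (suc j) *ᶻ F a n)
    Dblk-moment j a<m j< with b , b<m , refl ← next-surjective a<m = begin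
      S n (λ i → C i j *ᶻ Dblk A B (next b) i)
        ≡⟨ S-cong n (λ i _ → trans (lem (C i j) (D A B b i) (Dblk A B (next b) i)) (cong (λ y → C i j *ᶻ D A B b i -ᶻ C i j *ᶻ y) (sym (F-step i b<m)))) ⟩
      S n (λ i → C i j *ᶻ D A B b i -ᶻ C i j *ᶻ F (next b) (suc i))
        ≡⟨ S-- n (λ i → C i j *ᶻ D A B b i) (λ i → C i j *ᶻ F (next b) (suc i)) ⟩
      S n (λ i → C i j *ᶻ D A B b i) -ᶻ S n (λ i → C i j *ᶻ F (next b) (suc i))
        ≡⟨ cong₂ _-ᶻ_ (O b b<m j (m<n⇒m<1+n j<)) (sym (abel n j (F (next b)))) ⟩
      0ℤ -ᶻ (S n (λ i → C i (suc j) *ᶻ (F (next b) i -ᶻ F (next b) (suc i))) +ᶻ C n (suc j) *ᶻ F (next b) n)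
        ≡⟨ cong (λ y → 0ℤ -ᶻ (y +ᶻ C n (suc j) *ᶻ F (next b) n)) (S-F-difference (suc j) b<m (s<s j<)) ⟩
      0ℤ -ᶻ (0ℤ +ᶻ C n (suc j) *ᶻ F (next b) n)
        ≡⟨ lem′ (C n (suc j) *ᶻ F (next b) n) ⟩
      -1ℤ *ᶻ (C n (suc j) *ᶻ F (next b) n) ∎
      where
      lem : ∀ c x y → c *ᶻ y ≡ c *ᶻ x -ᶻ c *ᶻ (x -ᶻ y)
      lem = solve-∀
      lem′ : ∀ x → 0ℤ -ᶻ (0ℤ +ᶻ x) ≡ -1ℤ *ᶻ x
      lem′ = solve-∀

    S-Dblk : ∀ {a} → a < m → S n (Dblk A B a) ≡ + n *ᶻ (-1ℤ *ᶻ (excess a A -ᶻ excess a B))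
    S-Dblk {a} a<m = begin
      S n (Dblk A B a)                        ≡⟨ S-cong n (λ i _ → ℤₚ.*-identityˡ (Dblk A B a i)) ⟨
      S n (λ i → 1ℤ *ᶻ Dblk A B a i)          ≡⟨ Dblk-moment 0 a<m z<s ⟩
      -1ℤ *ᶻ (C n 1 *ᶻ F a n)                 ≡⟨ cong₂ (λ x y → -1ℤ *ᶻ (x *ᶻ y)) (C-1 n) (sym (F-ends a<m)) ⟩
      -1ℤ *ᶻ (+ n *ᶻ F a 0)                   ≡⟨ lem (+ n) (F a 0) ⟩
      + n *ᶻ (-1ℤ *ᶻ F a 0)                   ≡⟨ cong₂ (λ x y → + n *ᶻ (-1ℤ *ᶻ (excess a x -ᶻ excess a y))) (+-identityʳ A) (+-identityʳ B) ⟩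
      + n *ᶻ (-1ℤ *ᶻ (excess a A -ᶻ excess a B)) ∎
      where
      lem : ∀ x y → -1ℤ *ᶻ (x *ᶻ y) ≡ x *ᶻ (-1ℤ *ᶻ y)
      lem = solve-∀

    -- By `S-Dblk`, n differences of indicators sum to n times a number that is at least 1, yet the
    -- sum is at most n. So every difference is 1 and that number is exactly 1.
    extremal : ∀ {a} → 0 < n → a < m → excess a A -ᶻ excess a B ≤ᶻ -1ℤ →
      (∀ i → i < n → blk (A + i) ≡ a) × excess a A -ᶻ excess a B ≡ -1ℤ
    extremal {a} 0<n a<m e≤ = (λ i i<n → δ-δ≡1 _ (blk (B + i)) a (all-1 i i<n)) ,
      (begin
        e                            ≡⟨ lem e ⟩
        -1ℤ *ᶻ (-1ℤ *ᶻ e)            ≡⟨ cong (-1ℤ *ᶻ_) (ℤₚ.*-cancelˡ-≡ (+ n) (-1ℤ *ᶻ e) 1ℤ {{>-nonZero 0<n}} (trans (sym (S-Dblk a<m)) (trans (S-cong n all-1) (S-const n 1ℤ)))) ⟩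
        -1ℤ                          ∎)
      where
      e = excess a A -ᶻ excess a B
      lem : ∀ x → x ≡ -1ℤ *ᶻ (-1ℤ *ᶻ x)
      lem = solve-∀
      n≤S : + n ≤ᶻ S n (Dblk A B a)
      n≤S = subst₂ _≤ᶻ_ (ℤₚ.*-identityʳ (+ n)) (sym (S-Dblk a<m))
        (ℤₚ.*-monoˡ-≤-nonNeg (+ n) (subst (1ℤ ≤ᶻ_) (sym (ℤₚ.-1*i≡-i e)) (ℤₚ.neg-mono-≤ e≤)))
      all-1 : ∀ i → i < n → Dblk A B a i ≡ 1ℤ
      all-1 = S-extremal n (λ i _ → δ-δ≤1 (blk (A + i)) (blk (B + i)) a) n≤S

  -- This makes the partial first block p common to both factors. At offset 0 the head p can be
  -- taken empty, and the block letters may differ.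
  Aligned : ℕ → ℕ → Set
  Aligned A B = A % m ≡ B % m × (A % m ≡ 0 ⊎ blk A ≡ blk B)

  -- At offset 0 both excesses vanish; otherwise equal block letters and equal offsets give equal
  -- letters. So F is zero at the left end, and by `F-ends` at the right end.
  Aligned⇒excess≡ : ∀ {A B} → Aligned A B → ∀ a → excess a A -ᶻ excess a B ≡ 0ℤ
  Aligned⇒excess≡ {A} {B} (r≡ , cond) a = ℤₚ.i≡j⇒i-j≡0 {excess a A} (helper cond)
    where
    start : ∀ x → x % m ≡ 0 → excess a x ≡ 0ℤ
    start x r≡0 = ℤₚ.i≡j⇒i-j≡0 {δ (τ x) a} (cong (λ y → δ y a) (begin
      τ x                    ≡⟨ τ≡blk+offset x ⟩
      (blk x + x % m) % m    ≡⟨ cong (λ y → (blk x + y) % m) r≡0 ⟩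
      (blk x + 0) % m        ≡⟨ cong (_% m) (+-identityʳ _) ⟩
      blk x % m              ≡⟨ m<n⇒m%n≡m (τ<m (x / m)) ⟩
      blk x                  ∎))
    helper : A % m ≡ 0 ⊎ blk A ≡ blk B → excess a A ≡ excess a B
    helper (inj₁ r≡0) = trans (start A r≡0) (sym (start B (trans (sym r≡) r≡0)))
    helper (inj₂ c≡c′) = cong₂ (λ h c → δ h a -ᶻ δ c a)
      (trans (τ≡blk+offset A) (trans (cong₂ (λ c r → (c + r) % m) c≡c′ r≡) (sym (τ≡blk+offset B)))) c≡c′

  -- Even across a boundary the letter advances by one: the next block starts with its own letter,
  -- which is also the old block letter and hence the successor of the last letter.
  same-block-run : ∀ n A c → (∀ i → i < n → blk (A + i) ≡ c) → ∀ i → suc i < n → τ (A + suc i) ≡ next (τ (A + i))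
  same-block-run n A c const i i+1<n rewrite +-suc A i with t-step (A + i)
  ... | inj₁ (_ , step)    = step
  ... | inj₂ (start , end) = trans start (trans same (sym end))
    where
    same : blk (suc (A + i)) ≡ blk (A + i)
    same = trans (trans (cong blk (sym (+-suc A i))) (const (suc i) i+1<n)) (sym (const i (<-trans (n<1+n i) i+1<n)))

  open Telescoping using (extremal)

  module _ (K n : ℕ) (0<n : 0 < n) where

    -- For h = τ A, extremality forces every block of B to carry h, and then the difference of the excesses is -2, not -1.
    τ≢∧τ≢blk⇒⊥ : ∀ A B → Moments (suc (suc K)) n A B → τ A ≢ τ B → τ A ≢ blk A → ⊥
    τ≢∧τ≢blk⇒⊥ A B O h≢h′ h≢c with extremal K n B A (Moments-sym (suc (suc K)) n A B O) 0<n (τ<m A) bound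
      where
      bound : excess (τ A) B -ᶻ excess (τ A) A ≤ᶻ -1ℤ
      bound rewrite δ-refl (τ A) | δ-≢ (λ e → h≢h′ (sym e)) | δ-≢ (λ e → h≢c (sym e)) with δ-0∨1 (blk B) (τ A)
      ... | inj₁ (_ , eq) rewrite eq = -≤- z≤n
      ... | inj₂ (_ , eq) rewrite eq = -≤- z≤n
    ... | all-h , e≡-1 = absurd e≡-1
      where
      c′≡h : blk B ≡ τ A
      c′≡h = trans (cong blk (sym (+-identityʳ B))) (all-h 0 0<n)
      absurd : ¬ (excess (τ A) B -ᶻ excess (τ A) A ≡ -1ℤ)
      absurd rewrite c′≡h | δ-refl (τ A) | δ-≢ (λ e → h≢h′ (sym e)) | δ-≢ (λ e → h≢c (sym e)) = λ ()

    -- At the letter `blk A` the equal first letters cancel in the excesses and the block letters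
    -- contribute -1, which is the hypothesis of `extremal`.
    separated⇒blk-constant : ∀ A B → Moments (suc (suc K)) n A B → τ A ≡ τ B → blk A ≢ blk B → ∀ i → i < n → blk (A + i) ≡ blk A
    separated⇒blk-constant A B O h≡h′ c≢c′ = proj₁ (extremal K n A B O 0<n (τ<m (A / m)) (ℤₚ.≤-reflexive bound))
      where
      lem : ∀ x → (x -ᶻ 1ℤ) -ᶻ (x -ᶻ 0ℤ) ≡ -1ℤ
      lem = solve-∀
      bound : excess (blk A) A -ᶻ excess (blk A) B ≡ -1ℤ
      bound rewrite h≡h′ | δ-refl (blk A) | δ-≢ (λ e → c≢c′ (sym e)) = lem (δ (τ B) (blk A))

    dichotomy : ∀ A B → Moments (suc (suc K)) n A B → Aligned A B ⊎ (∀ i → i < n → τ (A + i) ≡ τ (B + i))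
    dichotomy A B O with τ A ≟ τ B | blk A ≟ blk B | τ A ≟ blk A | τ B ≟ blk B
    ... | yes h≡h′ | yes c≡c′ | _ | _ = inj₁ (%-cancelˡ-+ m (blk A) (m%n<n A m) (m%n<n B m) (begin
      (blk A + A % m) % m  ≡⟨ τ≡blk+offset A ⟨
      τ A                  ≡⟨ h≡h′ ⟩
      τ B                  ≡⟨ τ≡blk+offset B ⟩
      (blk B + B % m) % m  ≡⟨ cong (λ c → (c + B % m) % m) c≡c′ ⟨
      (blk A + B % m) % m  ∎) , inj₂ c≡c′)
    ... | yes h≡h′ | no c≢c′ | _ | _ = inj₂ runs
      where
      runs : ∀ i → i < n → τ (A + i) ≡ τ (B + i)
      runs zero    _     = trans (cong τ (+-identityʳ A)) (trans h≡h′ (cong τ (sym (+-identityʳ B))))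
      runs (suc i) i+1<n = begin
        τ (A + suc i)                 ≡⟨ same-block-run n A _ (separated⇒blk-constant A B O h≡h′ c≢c′) i i+1<n ⟩
        next (τ (A + i))        ≡⟨ cong (next) (runs i (<-trans (n<1+n i) i+1<n)) ⟩
        next (τ (B + i))        ≡⟨ same-block-run n B _ (separated⇒blk-constant B A (Moments-sym (suc (suc K)) n A B O) (sym h≡h′) (λ e → c≢c′ (sym e))) i i+1<n ⟨
        τ (B + suc i)                 ∎
    ... | no h≢h′ | _ | no h≢c  | _        = ⊥-elim (τ≢∧τ≢blk⇒⊥ A B O h≢h′ h≢c)
    ... | no h≢h′ | _ | yes _   | no h′≢c′ = ⊥-elim (τ≢∧τ≢blk⇒⊥ B A (Moments-sym (suc (suc K)) n A B O) (λ e → h≢h′ (sym e)) h′≢c′)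
    ... | no h≢h′ | _ | yes h≡c | yes h′≡c′ = inj₁ (trans (offset A h≡c) (sym (offset B h′≡c′)) , inj₁ (offset A h≡c))
      where
      offset : ∀ x → τ x ≡ blk x → x % m ≡ 0
      offset x eq = %-cancelˡ-+ m (blk x) (m%n<n x m) (>-nonZero⁻¹ m) (begin
        (blk x + x % m) % m  ≡⟨ τ≡blk+offset x ⟨
        τ x                  ≡⟨ eq ⟩
        blk x                ≡⟨ m<n⇒m%n≡m (τ<m (x / m)) ⟨
        blk x % m            ≡⟨ cong (_% m) (+-identityʳ (blk x)) ⟨
        (blk x + 0) % m      ∎)

  blk-digit : ∀ {r} q → r < m → blk (r + q * m) ≡ τ q
  blk-digit q r<m = cong τ ([r+q*m]/m≡q m q r<m)

  record CommonHead (A B : ℕ) : Set where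
    field
      l α β : ℕ
      A+l   : A + l ≡ α * m
      B+l   : B + l ≡ β * m
      head  : ∀ i → i < l → blk (A + i) ≡ blk (B + i)

  Aligned⇒CommonHead : ∀ {A B} → Aligned A B → CommonHead A B
  Aligned⇒CommonHead {A} {B} (r≡ , inj₁ r≡0) = record
    { l = 0 ; α = A / m ; β = B / m ; A+l = start A r≡0 ; B+l = start B (trans (sym r≡) r≡0) ; head = λ _ () }
    where
    start : ∀ x → x % m ≡ 0 → x + 0 ≡ x / m * m
    start x eq = trans (+-identityʳ x) (trans (m≡m%n+[m/n]*n x m) (cong (_+ x / m * m) eq))
  Aligned⇒CommonHead {A} {B} (r≡ , inj₂ c≡c′) = record
    { l = m ∸ A % m ; α = suc (A / m) ; β = suc (B / m)
    ; A+l = end A ; B+l = trans (cong (λ r → B + (m ∸ r)) r≡) (end B)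
    ; head = λ i i<l → trans (inside A i i<l) (trans c≡c′ (sym (inside B i (subst (λ r → i < m ∸ r) r≡ i<l)))) }
    where
    end : ∀ x → x + (m ∸ x % m) ≡ suc (x / m) * m
    end x = begin
      x + (m ∸ x % m)                         ≡⟨ cong (_+ (m ∸ x % m)) (m≡m%n+[m/n]*n x m) ⟩
      x % m + x / m * m + (m ∸ x % m)         ≡⟨ +-comm _ (m ∸ x % m) ⟩
      m ∸ x % m + (x % m + x / m * m)         ≡⟨ +-assoc (m ∸ x % m) _ _ ⟨
      m ∸ x % m + x % m + x / m * m           ≡⟨ cong (_+ x / m * m) (m∸n+n≡m (m%n≤n x m)) ⟩
      suc (x / m) * m                         ∎
    inside : ∀ x i → i < m ∸ x % m → blk (x + i) ≡ blk x
    inside x i i<l = trans (cong blk split) (blk-digit (x / m) (subst (_< m) (+-comm i (x % m)) (m≤o∸n⇒m+n≤o (suc i) (m%n≤n x m) i<l)))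
      where
      split : x + i ≡ x % m + i + x / m * m
      split = begin
        x + i                        ≡⟨ cong (_+ i) (m≡m%n+[m/n]*n x m) ⟩
        x % m + x / m * m + i        ≡⟨ +-assoc (x % m) _ i ⟩
        x % m + (x / m * m + i)      ≡⟨ cong (λ y → x % m + y) (+-comm _ i) ⟩
        x % m + (i + x / m * m)      ≡⟨ +-assoc (x % m) i _ ⟨
        x % m + i + x / m * m        ∎

  past-head : ∀ {A l α} → A + l ≡ α * m → ∀ x s → A + (l + (x * m + s)) ≡ s + (α + x) * m
  past-head {A} {l} {α} eq x s = begin
    A + (l + (x * m + s))      ≡⟨ +-assoc A l _ ⟨
    A + l + (x * m + s)        ≡⟨ cong (_+ (x * m + s)) eq ⟩
    α * m + (x * m + s)        ≡⟨ +-assoc (α * m) _ s ⟨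
    α * m + x * m + s          ≡⟨ cong (_+ s) (*-distribʳ-+ m α x) ⟨
    (α + x) * m + s            ≡⟨ +-comm _ s ⟩
    s + (α + x) * m            ∎

  Determined : ℕ → Set
  Determined K = ∀ n A B → n < 2 * m ^ K → Moments (suc K) n A B → ∀ i → i < n → τ (A + i) ≡ τ (B + i)

  module Desubstitution (K n A B : ℕ) (O : Moments (suc (suc K)) n A B) (aligned : Aligned A B)
    (n< : n < 2 * m ^ suc K) (IH : Determined K) where

    open CommonHead (Aligned⇒CommonHead aligned)
    open Telescoping K n A B O using (F; F-ends; Dblk-moment)

    F-end≡0 : ∀ {a} → a < m → F a n ≡ 0ℤ
    F-end≡0 {a} a<m = trans (sym (F-ends a<m))
      (trans (cong₂ (λ x y → excess a x -ᶻ excess a y) (+-identityʳ A) (+-identityʳ B)) (Aligned⇒excess≡ aligned a))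

    Dblk-Orth : ∀ {a} → a < m → Orth n (suc K) (Dblk A B a)
    Dblk-Orth {a} a<m j j< = trans (Dblk-moment j a<m j<)
      (trans (cong (λ y → -1ℤ *ᶻ (C n (suc j) *ᶻ y)) (F-end≡0 a<m)) (cong (-1ℤ *ᶻ_) (ℤₚ.*-zeroʳ (C n (suc j)))))

    n′ r₂ : ℕ
    n′ = (n ∸ l) / m
    r₂ = (n ∸ l) % m

    module _ (l≤n : l ≤ n) where

      n≡ : n ≡ l + (n′ * m + r₂)
      n≡ = begin
        n                        ≡⟨ m+[n∸m]≡n l≤n ⟨
        l + (n ∸ l)              ≡⟨ cong (λ y → l + y) (m≡m%n+[m/n]*n (n ∸ l) m) ⟩
        l + (r₂ + n′ * m)        ≡⟨ cong (λ y → l + y) (+-comm r₂ _) ⟩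
        l + (n′ * m + r₂)        ∎

      tail : 0 < r₂ → τ (α + n′) ≡ τ (β + n′)
      tail 0<r₂ with τ (β + n′) ≟ τ (α + n′)
      ... | yes d′≡d = sym d′≡d
      ... | no  d′≢d = ⊥-elim (absurd (subst₂ _≡_ excess-A excess-B
              (ℤₚ.i-j≡0⇒i≡j (excess d (A + n)) (excess d (B + n)) (F-end≡0 (τ<m (α + n′))))) (δ-≥0 (τ (B + n)) d))
        where
        d : ℕ
        d = τ (α + n′)
        A+n : A + n ≡ r₂ + (α + n′) * m
        A+n = trans (cong (λ y → A + y) n≡) (past-head {A} {l} {α} A+l n′ r₂)
        B+n : B + n ≡ r₂ + (β + n′) * m
        B+n = trans (cong (λ y → B + y) n≡) (past-head {B} {l} {β} B+l n′ r₂)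
        r₂<m : r₂ < m
        r₂<m = m%n<n (n ∸ l) m
        e≢d : τ (A + n) ≢ d
        e≢d e≡d = <⇒≢ 0<r₂ (sym (%-cancelˡ-+ m d r₂<m (>-nonZero⁻¹ m) (begin
          (d + r₂) % m             ≡⟨ τ-digit (α + n′) r₂<m ⟨
          τ (r₂ + (α + n′) * m)    ≡⟨ cong τ A+n ⟨
          τ (A + n)                ≡⟨ e≡d ⟩
          d                        ≡⟨ m<n⇒m%n≡m (τ<m (α + n′)) ⟨
          d % m                    ≡⟨ cong (_% m) (+-identityʳ d) ⟨
          (d + 0) % m              ∎)))
        excess-A : excess d (A + n) ≡ -1ℤ
        excess-A = cong₂ _-ᶻ_ (δ-≢ e≢d) (trans (cong (λ y → δ y d) (trans (cong blk A+n) (blk-digit (α + n′) r₂<m))) (δ-refl d))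
        excess-B : excess d (B + n) ≡ δ (τ (B + n)) d
        excess-B = trans (cong (δ (τ (B + n)) d -ᶻ_) (trans (cong (λ y → δ y d) (trans (cong blk B+n) (blk-digit (β + n′) r₂<m))) (δ-≢ d′≢d)))
          (ℤₚ.+-identityʳ (δ (τ (B + n)) d))
        absurd : ∀ {x} → -1ℤ ≡ x → 0ℤ ≤ᶻ x → ⊥
        absurd refl ()

      Dblk-past-head : ∀ a x s → s < m → Dblk A B a (l + (x * m + s)) ≡ D α β a x
      Dblk-past-head a x s s<m = cong₂ (λ y z → δ y a -ᶻ δ z a)
        (trans (cong blk (past-head {A} {l} {α} A+l x s)) (blk-digit (α + x) s<m))
        (trans (cong blk (past-head {B} {l} {β} B+l x s)) (blk-digit (β + x) s<m))

      *-δ-same : ∀ c {x y} → x ≡ y → ∀ a → c *ᶻ (δ x a -ᶻ δ y a) ≡ 0ℤ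
      *-δ-same c {x} refl a = trans (cong (c *ᶻ_) (ℤₚ.+-inverseʳ (δ x a))) (ℤₚ.*-zeroʳ c)

      middle : ∀ a → a < m → ∀ j → j < suc K → S (n′ * m) (λ x → C (l + x) j *ᶻ Dblk A B a (l + x)) ≡ 0ℤ
      middle a a<m j j< = begin
        S (n′ * m) (λ x → f (l + x))
          ≡⟨ ℤₚ.+-identityʳ _ ⟨
        S (n′ * m) (λ x → f (l + x)) +ᶻ 0ℤ
          ≡⟨ cong (S (n′ * m) (λ x → f (l + x)) +ᶻ_) (S-zero r₂ tail-vanishes) ⟨
        S (n′ * m) (λ x → f (l + x)) +ᶻ S r₂ (λ s → f (l + (n′ * m + s)))
          ≡⟨ S-split (n′ * m) r₂ (λ x → f (l + x)) ⟨
        S (n′ * m + r₂) (λ x → f (l + x))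
          ≡⟨ ℤₚ.+-identityˡ _ ⟨
        0ℤ +ᶻ S (n′ * m + r₂) (λ x → f (l + x))
          ≡⟨ cong (_+ᶻ S (n′ * m + r₂) (λ x → f (l + x))) (S-zero l (λ i i<l → *-δ-same (C i j) (head i i<l) a)) ⟨
        S l f +ᶻ S (n′ * m + r₂) (λ x → f (l + x))
          ≡⟨ S-split l (n′ * m + r₂) f ⟨
        S (l + (n′ * m + r₂)) f
          ≡⟨ cong (λ y → S y f) n≡ ⟨
        S n f
          ≡⟨ Dblk-Orth a<m j j< ⟩
        0ℤ ∎
        where
        f : ℕ → ℤ
        f i = C i j *ᶻ Dblk A B a i
        tail-vanishes : ∀ s → s < r₂ → f (l + (n′ * m + s)) ≡ 0ℤ
        tail-vanishes s s<r₂ = trans (cong (C (l + (n′ * m + s)) j *ᶻ_) (Dblk-past-head a n′ s (<-trans s<r₂ (m%n<n (n ∸ l) m))))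
          (*-δ-same (C (l + (n′ * m + s)) j) (tail (≤-<-trans z≤n s<r₂)) a)

      n′< : n′ < 2 * m ^ K
      n′< = *-cancelʳ-< m n′ (2 * m ^ K) (≤-<-trans (≤-trans (m≤m+n (n′ * m) r₂) (≤-trans (m≤n+m _ l) (≤-reflexive (sym n≡))))
        (subst (n <_) (trans (cong (2 *_) (*-comm m (m ^ K))) (sym (*-assoc 2 (m ^ K) m))) n<))

      τ-middle : ∀ x → x < n′ → τ (α + x) ≡ τ (β + x)
      τ-middle = IH n′ α β n′< (λ a a<m → Orth-unstretch m l n′ (suc K) (λ x s _ s<m → Dblk-past-head a x s s<m) (middle a a<m))

      blk-past-head : ∀ y → l + y < n → blk (A + (l + y)) ≡ blk (B + (l + y))
      blk-past-head y l+y<n = begin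
        blk (A + (l + y))                        ≡⟨ cong (λ z → blk (A + (l + z))) y≡ ⟩
        blk (A + (l + (y / m * m + y % m)))      ≡⟨ cong blk (past-head {A} {l} {α} A+l (y / m) (y % m)) ⟩
        blk (y % m + (α + y / m) * m)            ≡⟨ blk-digit (α + y / m) (m%n<n y m) ⟩
        τ (α + y / m)                            ≡⟨ quotient (m<1+n⇒m<n∨m≡n (s≤s (/-monoˡ-≤ m (<⇒≤ y<)))) ⟩
        τ (β + y / m)                            ≡⟨ blk-digit (β + y / m) (m%n<n y m) ⟨
        blk (y % m + (β + y / m) * m)            ≡⟨ cong blk (past-head {B} {l} {β} B+l (y / m) (y % m)) ⟨
        blk (B + (l + (y / m * m + y % m)))      ≡⟨ cong (λ z → blk (B + (l + z))) y≡ ⟨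
        blk (B + (l + y))                        ∎
        where
        y≡ : y ≡ y / m * m + y % m
        y≡ = trans (m≡m%n+[m/n]*n y m) (+-comm (y % m) _)
        y< : y < n ∸ l
        y< = m+n≤o⇒m≤o∸n (suc y) (subst (λ z → suc z ≤ n) (+-comm l y) l+y<n)
        quotient : y / m < n′ ⊎ y / m ≡ n′ → τ (α + y / m) ≡ τ (β + y / m)
        quotient (inj₁ q<n′) = τ-middle (y / m) q<n′
        quotient (inj₂ q≡n′) rewrite q≡n′ = tail (≤-<-trans z≤n (+-cancelʳ-< (n′ * m) (y % m) r₂
          (subst₂ _<_ (trans (m≡m%n+[m/n]*n y m) (cong (λ q → y % m + q * m) q≡n′)) (m≡m%n+[m/n]*n (n ∸ l) m) y<)))

    blk-equal : ∀ i → i < n → blk (A + i) ≡ blk (B + i)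
    blk-equal i i<n with i <? l
    ... | yes i<l = head i i<l
    ... | no  i≮l = subst (λ z → blk (A + z) ≡ blk (B + z)) (m+[n∸m]≡n l≤i)
      (blk-past-head (≤-trans l≤i (<⇒≤ i<n)) (i ∸ l) (subst (_< n) (sym (m+[n∸m]≡n l≤i)) i<n))
      where
      l≤i : l ≤ i
      l≤i = ≮⇒≥ i≮l

    τ-equal : ∀ i → i < n → τ (A + i) ≡ τ (B + i)
    τ-equal i i<n = begin
      τ (A + i)                                ≡⟨ τ≡blk+offset (A + i) ⟩
      (blk (A + i) + (A + i) % m) % m          ≡⟨ cong₂ (λ x y → (x + y) % m) (blk-equal i i<n) offsets ⟩
      (blk (B + i) + (B + i) % m) % m          ≡⟨ τ≡blk+offset (B + i) ⟨
      τ (B + i)                                ∎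
      where
      offsets : (A + i) % m ≡ (B + i) % m
      offsets = trans (sym (%-+ˡ m A i)) (trans (cong (λ r → (r + i) % m) (proj₁ aligned)) (%-+ˡ m B i))

  determined : ∀ K → Determined K
  determined zero (suc zero) A B n< O zero i<n = δ-injective (ℤₚ.i-j≡0⇒i≡j (δ a a) (δ (τ (B + 0)) a)
    (trans (lem (D A B a 0)) (O a (τ<m (A + 0)) 0 z<s)))
    where
    a : ℕ
    a = τ (A + 0)
    lem : ∀ x → x ≡ 0ℤ +ᶻ 1ℤ *ᶻ x
    lem = solve-∀
  determined zero (suc zero) A B n< O (suc i) (s<s ())
  determined zero (suc (suc n)) A B (s<s (s<s ())) O
  determined (suc K) n A B n< O i i<n with dichotomy K n (≤-<-trans z≤n i<n) A B O
  ... | inj₁ aligned = Desubstitution.τ-equal K n A B O aligned n< (determined K) i i<n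
  ... | inj₂ equal   = equal i i<n

-- Moments from binomial coefficients

S-δ : ∀ n c {x} → c < n → S n (λ b → δ c b *ᶻ x) ≡ x
S-δ (suc n) c {x} c<1+n with m<1+n⇒m<n∨m≡n c<1+n
... | inj₁ c<n  = begin
  S n (λ b → δ c b *ᶻ x) +ᶻ δ c n *ᶻ x  ≡⟨ cong₂ (λ y z → y +ᶻ z *ᶻ x) (S-δ n c c<n) (δ-≢ (<⇒≢ c<n)) ⟩
  x +ᶻ 0ℤ *ᶻ x                          ≡⟨ lem x ⟩
  x                                     ∎
  where
  lem : ∀ x → x +ᶻ 0ℤ *ᶻ x ≡ x
  lem = solve-∀
... | inj₂ refl = begin
  S n (λ b → δ n b *ᶻ x) +ᶻ δ n n *ᶻ x  ≡⟨ cong₂ (λ y z → y +ᶻ z *ᶻ x) (S-zero n (λ b b<n → cong (_*ᶻ x) (δ-≢ (λ e → <⇒≢ b<n (sym e))))) (δ-refl n) ⟩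
  0ℤ +ᶻ 1ℤ *ᶻ x                         ≡⟨ lem x ⟩
  x                                     ∎
  where
  lem : ∀ x → 0ℤ +ᶻ 1ℤ *ᶻ x ≡ x
  lem = solve-∀

module _ (m : ℕ) where

  sumWords : ℕ → (List ℕ → ℤ) → ℤ
  sumWords zero    f = f []
  sumWords (suc j) f = S m (λ b → sumWords j (λ y → f (b ∷ y)))

  sumWords-cong : ∀ j {f g} → (∀ y → All (_< m) y → length y ≡ j → f y ≡ g y) → sumWords j f ≡ sumWords j g
  sumWords-cong zero    eq = eq [] [] refl
  sumWords-cong (suc j) eq = S-cong m (λ b b<m → sumWords-cong j (λ y y<m len → eq (b ∷ y) (b<m ∷ y<m) (cong suc len)))

  sumWords-+ : ∀ j (f g : List ℕ → ℤ) → sumWords j (λ y → f y +ᶻ g y) ≡ sumWords j f +ᶻ sumWords j g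
  sumWords-+ zero    f g = refl
  sumWords-+ (suc j) f g = trans (S-cong m (λ b _ → sumWords-+ j (λ y → f (b ∷ y)) (λ y → g (b ∷ y))))
    (S-+ m (λ b → sumWords j (λ y → f (b ∷ y))) (λ b → sumWords j (λ y → g (b ∷ y))))

  sumWords-* : ∀ j c (f : List ℕ → ℤ) → sumWords j (λ y → c *ᶻ f y) ≡ c *ᶻ sumWords j f
  sumWords-* zero    c f = refl
  sumWords-* (suc j) c f = trans (S-cong m (λ b _ → sumWords-* j c (λ y → f (b ∷ y)))) (S-* m c (λ b → sumWords j (λ y → f (b ∷ y))))

  sumWords-0 : ∀ j → sumWords j (λ _ → 0ℤ) ≡ 0ℤ
  sumWords-0 zero    = refl
  sumWords-0 (suc j) = S-zero m (λ _ _ → sumWords-0 j)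

  moment : List ℕ → ℕ → ℕ → ℤ
  moment u a j = sumWords j (λ y → + binom u (y ++ a ∷ []))

  +-if : ∀ c b n → + (if c ≡ᵇ b then n else 0) ≡ δ c b *ᶻ + n
  +-if c b n with c ≡ᵇ b
  ... | true  = sym (ℤₚ.*-identityˡ (+ n))
  ... | false = refl

  moment-[] : ∀ a j → moment [] a j ≡ 0ℤ
  moment-[] a j = trans (sumWords-cong j (λ { [] _ _ → refl ; (_ ∷ _) _ _ → refl })) (sumWords-0 j)

  moment-∷-zero : ∀ c u a → moment (c ∷ u) a 0 ≡ moment u a 0 +ᶻ δ c a
  moment-∷-zero c u a = trans (ℤₚ.pos-+ (binom u (a ∷ [])) _)
    (cong (moment u a 0 +ᶻ_) (trans (+-if c a 1) (ℤₚ.*-identityʳ (δ c a))))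

  moment-∷-suc : ∀ {c} u a j → c < m → moment (c ∷ u) a (suc j) ≡ moment u a (suc j) +ᶻ moment u a j
  moment-∷-suc {c} u a j c<m = begin
    S m (λ b → sumWords j (λ y → + binom (c ∷ u) (b ∷ y ++ a ∷ [])))
      ≡⟨ S-cong m (λ b _ → trans (sumWords-cong j (λ y _ _ → trans (ℤₚ.pos-+ (binom u (b ∷ y ++ a ∷ [])) _)
           (cong (+ binom u (b ∷ y ++ a ∷ []) +ᶻ_) (+-if c b (binom u (y ++ a ∷ [])))))) (sumWords-+ j (λ y → + binom u (b ∷ y ++ a ∷ [])) (λ y → δ c b *ᶻ + binom u (y ++ a ∷ [])))) ⟩
    S m (λ b → sumWords j (λ y → + binom u (b ∷ y ++ a ∷ [])) +ᶻ sumWords j (λ y → δ c b *ᶻ + binom u (y ++ a ∷ [])))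
      ≡⟨ S-+ m (λ b → sumWords j (λ y → + binom u (b ∷ y ++ a ∷ []))) (λ b → sumWords j (λ y → δ c b *ᶻ + binom u (y ++ a ∷ []))) ⟩
    moment u a (suc j) +ᶻ S m (λ b → sumWords j (λ y → δ c b *ᶻ + binom u (y ++ a ∷ [])))
      ≡⟨ cong (moment u a (suc j) +ᶻ_) (trans (S-cong m (λ b _ → sumWords-* j (δ c b) (λ y → + binom u (y ++ a ∷ [])))) (S-δ m c c<m)) ⟩
    moment u a (suc j) +ᶻ moment u a j ∎

  moment-applyUpTo : ∀ f → (∀ i → f i < m) → ∀ n a j → moment (applyUpTo f n) a j ≡ S n (λ i → C i j *ᶻ δ (f i) a)
  moment-applyUpTo f f<m zero    a j = moment-[] a j
  moment-applyUpTo f f<m (suc n) a zero = begin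
    moment (applyUpTo f (suc n)) a 0                           ≡⟨ moment-∷-zero (f 0) (applyUpTo (f ∘ suc) n) a ⟩
    moment (applyUpTo (f ∘ suc) n) a 0 +ᶻ δ (f 0) a            ≡⟨ cong (_+ᶻ δ (f 0) a) (moment-applyUpTo (f ∘ suc) (f<m ∘ suc) n a 0) ⟩
    S n (λ i → 1ℤ *ᶻ δ (f (suc i)) a) +ᶻ δ (f 0) a             ≡⟨ lem (S n (λ i → 1ℤ *ᶻ δ (f (suc i)) a)) (δ (f 0) a) ⟩
    1ℤ *ᶻ δ (f 0) a +ᶻ S n (λ i → 1ℤ *ᶻ δ (f (suc i)) a)       ≡⟨ S-front n (λ i → 1ℤ *ᶻ δ (f i) a) ⟨
    S (suc n) (λ i → 1ℤ *ᶻ δ (f i) a)                          ∎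
    where
    lem : ∀ x y → x +ᶻ y ≡ 1ℤ *ᶻ y +ᶻ x
    lem = solve-∀
  moment-applyUpTo f f<m (suc n) a (suc j) = begin
    moment (applyUpTo f (suc n)) a (suc j)
      ≡⟨ moment-∷-suc (applyUpTo (f ∘ suc) n) a j (f<m 0) ⟩
    moment (applyUpTo (f ∘ suc) n) a (suc j) +ᶻ moment (applyUpTo (f ∘ suc) n) a j
      ≡⟨ cong₂ _+ᶻ_ (moment-applyUpTo (f ∘ suc) (f<m ∘ suc) n a (suc j)) (moment-applyUpTo (f ∘ suc) (f<m ∘ suc) n a j) ⟩
    S n (λ i → C i (suc j) *ᶻ δ (f (suc i)) a) +ᶻ S n (λ i → C i j *ᶻ δ (f (suc i)) a)
      ≡⟨ S-+ n (λ i → C i (suc j) *ᶻ δ (f (suc i)) a) (λ i → C i j *ᶻ δ (f (suc i)) a) ⟨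
    S n (λ i → C i (suc j) *ᶻ δ (f (suc i)) a +ᶻ C i j *ᶻ δ (f (suc i)) a)
      ≡⟨ S-cong n (λ i _ → lem (C i (suc j)) (C i j) (δ (f (suc i)) a)) ⟩
    S n (λ i → C (suc i) (suc j) *ᶻ δ (f (suc i)) a)
      ≡⟨ ℤₚ.+-identityˡ _ ⟨
    0ℤ +ᶻ S n (λ i → C (suc i) (suc j) *ᶻ δ (f (suc i)) a)
      ≡⟨ S-front n (λ i → C i (suc j) *ᶻ δ (f i) a) ⟨
    S (suc n) (λ i → C i (suc j) *ᶻ δ (f i) a) ∎
    where
    lem : ∀ x y z → x *ᶻ z +ᶻ y *ᶻ z ≡ (y +ᶻ x) *ᶻ z
    lem = solve-∀

  BinEq⇒moment≡ : ∀ {k u v} → BinEq m k u v → ∀ a j → a < m → j < k → moment u a j ≡ moment v a j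
  BinEq⇒moment≡ {k} eq a j a<m j<k = sumWords-cong j (λ y y<m len → cong +_ (eq (y ++ a ∷ []) (++⁺ y<m (a<m ∷ []))
    (subst (_≤ k) (sym (trans (length-++ y) (trans (+-comm (length y) 1) (cong suc len)))) j<k)))

applyUpTo-cong : ∀ {f g : ℕ → ℕ} n → (∀ i → i < n → f i ≡ g i) → applyUpTo f n ≡ applyUpTo g n
applyUpTo-cong zero    eq = refl
applyUpTo-cong (suc n) eq = cong₂ _∷_ (eq 0 z<s) (applyUpTo-cong n (λ i i<n → eq (suc i) (s<s i<n)))

applyUpTo-++ : ∀ (f : ℕ → ℕ) n k → applyUpTo f (n + k) ≡ applyUpTo f n ++ applyUpTo (λ i → f (n + i)) k
applyUpTo-++ f zero    k = refl
applyUpTo-++ f (suc n) k = cong (f 0 ∷_) (applyUpTo-++ (f ∘ suc) n k)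

applyUpTo-rotate : ∀ (f : ℕ → ℕ) n → f n ≡ f 0 → applyUpTo (f ∘ suc) n ↭ applyUpTo f n
applyUpTo-rotate f zero    eq = refl
applyUpTo-rotate f (suc n) eq = ↭-trans
  (↭-reflexive (trans (sym (applyUpTo-∷ʳ (f ∘ suc) n)) (cong (applyUpTo (f ∘ suc) n ∷ʳ_) eq)))
  (↭-sym (∷↭∷ʳ (f 0) (applyUpTo (f ∘ suc) n)))

-- Binomial equivalence of products

conv : (List ℕ → ℕ) → (List ℕ → ℕ) → List ℕ → ℕ
conv f g []      = f [] * g []
conv f g (b ∷ w) = f [] * g (b ∷ w) + conv (λ y → f (b ∷ y)) g w

conv-0 : ∀ g w → conv (λ _ → 0) g w ≡ 0
conv-0 g []      = refl
conv-0 g (b ∷ w) = conv-0 g w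

conv-+ : ∀ f f′ g w → conv (λ y → f y + f′ y) g w ≡ conv f g w + conv f′ g w
conv-+ f f′ g []      = *-distribʳ-+ (g []) (f []) (f′ [])
conv-+ f f′ g (b ∷ w) = trans (cong (λ x → (f [] + f′ []) * g (b ∷ w) + x) (conv-+ (λ y → f (b ∷ y)) (λ y → f′ (b ∷ y)) g w))
  (lem (f []) (f′ []) (g (b ∷ w)) _ _)
  where
  lem : ∀ a b c d e → (a + b) * c + (d + e) ≡ a * c + d + (b * c + e)
  lem = ℕ-Solver.solve-∀

binom-++ : ∀ u v x → binom (u ++ v) x ≡ conv (binom u) (binom v) x
binom-++ []      v []      = refl
binom-++ []      v (b ∷ w) = sym (trans (cong (λ x → binom v (b ∷ w) + 0 + x) (conv-0 (binom v) w)) (trans (+-identityʳ _) (+-identityʳ _)))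
binom-++ (a ∷ u) v []      = refl
binom-++ (a ∷ u) v (b ∷ w) with a ≡ᵇ b
... | true = begin
  binom (u ++ v) (b ∷ w) + binom (u ++ v) w
    ≡⟨ cong₂ _+_ (binom-++ u v (b ∷ w)) (binom-++ u v w) ⟩
  1 * binom v (b ∷ w) + conv (λ y → binom u (b ∷ y)) (binom v) w + conv (binom u) (binom v) w
    ≡⟨ +-assoc (1 * binom v (b ∷ w)) _ _ ⟩
  1 * binom v (b ∷ w) + (conv (λ y → binom u (b ∷ y)) (binom v) w + conv (binom u) (binom v) w)
    ≡⟨ cong (λ x → 1 * binom v (b ∷ w) + x) (conv-+ (λ y → binom u (b ∷ y)) (binom u) (binom v) w) ⟨
  1 * binom v (b ∷ w) + conv (λ y → binom u (b ∷ y) + binom u y) (binom v) w ∎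
... | false = begin
  binom (u ++ v) (b ∷ w) + 0
    ≡⟨ cong (_+ 0) (binom-++ u v (b ∷ w)) ⟩
  1 * binom v (b ∷ w) + conv (λ y → binom u (b ∷ y)) (binom v) w + 0
    ≡⟨ +-assoc (1 * binom v (b ∷ w)) _ 0 ⟩
  1 * binom v (b ∷ w) + (conv (λ y → binom u (b ∷ y)) (binom v) w + 0)
    ≡⟨ cong (λ x → 1 * binom v (b ∷ w) + (conv (λ y → binom u (b ∷ y)) (binom v) w + x)) (conv-0 (binom v) w) ⟨
  1 * binom v (b ∷ w) + (conv (λ y → binom u (b ∷ y)) (binom v) w + conv (λ _ → 0) (binom v) w)
    ≡⟨ cong (λ x → 1 * binom v (b ∷ w) + x) (conv-+ (λ y → binom u (b ∷ y)) (λ _ → 0) (binom v) w) ⟨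
  1 * binom v (b ∷ w) + conv (λ y → binom u (b ∷ y) + 0) (binom v) w ∎

module _ (m : ℕ) where

  AgreeUpTo : ℕ → (f g : List ℕ → ℕ) → Set
  AgreeUpTo k f g = ∀ x → All (_< m) x → length x ≤ k → f x ≡ g x

  conv-cong : ∀ {f f′ g g′} w → All (_< m) w → AgreeUpTo (length w) f f′ → AgreeUpTo (length w) g g′ → conv f g w ≡ conv f′ g′ w
  conv-cong []      []          ff gg = cong₂ _*_ (ff [] [] z≤n) (gg [] [] z≤n)
  conv-cong (b ∷ w) (b<m ∷ w<m) ff gg = cong₂ _+_ (cong₂ _*_ (ff [] [] z≤n) (gg (b ∷ w) (b<m ∷ w<m) ≤-refl))
    (conv-cong w w<m (λ x x<m len → ff (b ∷ x) (b<m ∷ x<m) (s≤s len)) (λ x x<m len → gg x x<m (m≤n⇒m≤1+n len)))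

  -- The summand f w * g [] is the only one not controlled by the hypotheses, so the two of them are moved across.
  conv-exchange : ∀ {f f′ g g′} w → All (_< m) w → (∀ x → All (_< m) x → length x < length w → f x ≡ f′ x) →
    AgreeUpTo (length w) g g′ → g [] ≡ 1 → g′ [] ≡ 1 → conv f g w + f′ w ≡ conv f′ g′ w + f w
  conv-exchange {f} {f′} [] [] ff gg g≡1 g′≡1 rewrite g≡1 | g′≡1 | *-identityʳ (f []) | *-identityʳ (f′ []) = +-comm (f []) (f′ [])
  conv-exchange {f} {f′} {g} {g′} (b ∷ w) (b<m ∷ w<m) ff gg g≡1 g′≡1 = begin
    f [] * g (b ∷ w) + conv (λ y → f (b ∷ y)) g w + f′ (b ∷ w)        ≡⟨ +-assoc (f [] * g (b ∷ w)) _ _ ⟩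
    f [] * g (b ∷ w) + (conv (λ y → f (b ∷ y)) g w + f′ (b ∷ w))      ≡⟨ cong₂ _+_ (cong₂ _*_ (ff [] [] z<s) (gg (b ∷ w) (b<m ∷ w<m) ≤-refl))
      (conv-exchange {λ y → f (b ∷ y)} {λ y → f′ (b ∷ y)} w w<m (λ x x<m len → ff (b ∷ x) (b<m ∷ x<m) (s<s len)) (λ x x<m len → gg x x<m (m≤n⇒m≤1+n len)) g≡1 g′≡1) ⟩
    f′ [] * g′ (b ∷ w) + (conv (λ y → f′ (b ∷ y)) g′ w + f (b ∷ w))   ≡⟨ +-assoc (f′ [] * g′ (b ∷ w)) _ _ ⟨
    f′ [] * g′ (b ∷ w) + conv (λ y → f′ (b ∷ y)) g′ w + f (b ∷ w)     ∎

  BinEq-++ : ∀ {k u u′ v v′} → BinEq m k u u′ → BinEq m k v v′ → BinEq m k (u ++ v) (u′ ++ v′)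
  BinEq-++ {k} {u} {u′} {v} {v′} uu vv x x<m len = begin
    binom (u ++ v) x                ≡⟨ binom-++ u v x ⟩
    conv (binom u) (binom v) x      ≡⟨ conv-cong x x<m (λ y y<m l → uu y y<m (≤-trans l len)) (λ y y<m l → vv y y<m (≤-trans l len)) ⟩
    conv (binom u′) (binom v′) x    ≡⟨ binom-++ u′ v′ x ⟨
    binom (u′ ++ v′) x              ∎

  BinEq-swap : ∀ {k u v} → BinEq m k u v → BinEq m (suc k) (u ++ v) (v ++ u)
  BinEq-swap         uv []      x<m         len = refl
  BinEq-swap {k} {u} {v} uv (b ∷ w) (b<m ∷ w<m) (s≤s len) = begin
    binom (u ++ v) (b ∷ w)
      ≡⟨ binom-++ u v (b ∷ w) ⟩
    1 * binom v (b ∷ w) + conv (λ y → binom u (b ∷ y)) (binom v) w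
      ≡⟨ lem (binom v (b ∷ w)) _ ⟩
    conv (λ y → binom u (b ∷ y)) (binom v) w + binom v (b ∷ w)
      ≡⟨ conv-exchange {λ y → binom u (b ∷ y)} {λ y → binom v (b ∷ y)} w w<m (λ y y<m l → uv (b ∷ y) (b<m ∷ y<m) (≤-trans l len))
           (λ y y<m l → sym (uv y y<m (≤-trans l len))) refl refl ⟩
    conv (λ y → binom v (b ∷ y)) (binom u) w + binom u (b ∷ w)
      ≡⟨ lem (binom u (b ∷ w)) _ ⟨
    1 * binom u (b ∷ w) + conv (λ y → binom v (b ∷ y)) (binom u) w
      ≡⟨ binom-++ v u (b ∷ w) ⟨
    binom (v ++ u) (b ∷ w) ∎
    where
    lem : ∀ x y → 1 * x + y ≡ y + x
    lem = ℕ-Solver.solve-∀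

  concatMap-↭ : ∀ {k} (W : ℕ → List ℕ) → (∀ a b → BinEq m k (W a) (W b)) →
    ∀ {w w′} → w ↭ w′ → BinEq m (suc k) (concatMap W w) (concatMap W w′)
  concatMap-↭ W eq refl x x<m len = refl
  concatMap-↭ W eq (prep a p) = BinEq-++ {u = W a} (λ _ _ _ → refl) (concatMap-↭ W eq p)
  concatMap-↭ W eq {a ∷ b ∷ w} {_ ∷ _ ∷ w′} (swap a b p) x x<m len = begin
    binom (W a ++ W b ++ concatMap W w) x      ≡⟨ cong (λ u → binom u x) (++-assoc (W a) (W b) _) ⟨
    binom ((W a ++ W b) ++ concatMap W w) x    ≡⟨ BinEq-++ {u = W a ++ W b} (BinEq-swap {u = W a} (eq a b)) (concatMap-↭ W eq p) x x<m len ⟩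
    binom ((W b ++ W a) ++ concatMap W w′) x   ≡⟨ cong (λ u → binom u x) (++-assoc (W b) (W a) _) ⟩
    binom (W b ++ W a ++ concatMap W w′) x     ∎
  concatMap-↭ W eq (↭.trans p q) x x<m len = trans (concatMap-↭ W eq p x x<m len) (concatMap-↭ W eq q x x<m len)

module _ (m : ℕ) .{{_ : NonZero m}} where

  σ-applyUpTo : ∀ c → σ m c ≡ applyUpTo (λ j → (c + j) % m) m
  σ-applyUpTo c = map-upTo (λ j → (c + j) % m) m

  σ-suc-↭ : ∀ c → σ m (suc c) ↭ σ m c
  σ-suc-↭ c = ↭-trans (↭-reflexive (trans (σ-applyUpTo (suc c)) (applyUpTo-cong m (λ i _ → cong (_% m) (sym (+-suc c i))))))
    (↭-trans (applyUpTo-rotate (λ j → (c + j) % m) m (trans ([m+n]%n≡m%n c m) (cong (_% m) (sym (+-identityʳ c)))))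
      (↭-reflexive (sym (σ-applyUpTo c))))

  σ-↭ : ∀ c c′ → σ m c ↭ σ m c′
  σ-↭ c c′ = ↭-trans (to-0 c) (↭-sym (to-0 c′))
    where
    to-0 : ∀ c → σ m c ↭ σ m 0
    to-0 zero    = refl
    to-0 (suc c) = ↭-trans (σ-suc-↭ c) (to-0 c)

  σ^ : ℕ → ℕ → List ℕ
  σ^ zero    c = c ∷ []
  σ^ (suc K) c = concatMap (σ^ K) (σ m c)

  σ^-BinEq : ∀ K c c′ → BinEq m K (σ^ K c) (σ^ K c′)
  σ^-BinEq zero    c c′ [] _ _ = refl
  σ^-BinEq (suc K) c c′ = concatMap-↭ m (σ^ K) (σ^-BinEq K) (σ-↭ c c′)

  σ*-applyUpTo : ∀ n (f g : ℕ → ℕ) → (∀ q r → r < m → g (r + q * m) ≡ (f q + r) % m) →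
    σ* m (applyUpTo f n) ≡ applyUpTo g (n * m)
  σ*-applyUpTo zero    f g eq = refl
  σ*-applyUpTo (suc n) f g eq = begin
    σ m (f 0) ++ σ* m (applyUpTo (f ∘ suc) n)
      ≡⟨ cong₂ _++_ (trans (σ-applyUpTo (f 0)) (applyUpTo-cong m (λ r r<m → trans (sym (eq 0 r r<m)) (cong g (+-identityʳ r)))))
           (σ*-applyUpTo n (f ∘ suc) (λ i → g (m + i)) (λ q r r<m → trans (cong g (rotate q r)) (eq (suc q) r r<m))) ⟩
    applyUpTo g m ++ applyUpTo (λ i → g (m + i)) (n * m)
      ≡⟨ applyUpTo-++ g m (n * m) ⟨
    applyUpTo g (m + n * m) ∎
    where
    rotate : ∀ q r → m + (r + q * m) ≡ r + (m + q * m)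
    rotate q r = trans (sym (+-assoc m r _)) (trans (cong (_+ q * m) (+-comm m r)) (+-assoc r m _))

  concatMap-σ^-suc : ∀ K w → concatMap (σ^ (suc K)) w ≡ concatMap (σ^ K) (σ* m w)
  concatMap-σ^-suc K []      = refl
  concatMap-σ^-suc K (c ∷ w) = trans (cong (σ^ (suc K) c ++_) (concatMap-σ^-suc K w)) (sym (concatMap-++ (σ^ K) (σ m c) (σ* m w)))

-- The generalized Thue–Morse word

module _ (m : ℕ) .{{_ : NonZero m}} where

  length-σ : ∀ i → length (σ m i) ≡ m
  length-σ i = trans (length-map _ (upTo m)) (length-upTo m)

  length-σ* : ∀ w → length (σ* m w) ≡ length w * m
  length-σ* []      = refl
  length-σ* (a ∷ w) = trans (length-++ (σ m a)) (cong₂ _+_ (length-σ a) (length-σ* w))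

  length-σ^ : ∀ j → length (σ^[ j ] m) ≡ m ^ j
  length-σ^ zero    = refl
  length-σ^ (suc j) = trans (length-σ* (σ^[ j ] m)) (trans (cong (_* m) (length-σ^ j)) (*-comm (m ^ j) m))

  at-σ* : ∀ w q r → q < length w → r < m → at (σ* m w) (r + q * m) ≡ (at w q + r) % m
  at-σ* (a ∷ w) zero r q< r<m rewrite +-identityʳ r =
    trans (at-++ˡ (σ m a) (σ* m w) r (subst (r <_) (sym (length-σ a)) r<m))
          (at-map-applyUpTo (λ j → (a + j) % m) (λ j → j) m r r<m)
  at-σ* (a ∷ w) (suc q) r (s<s q<) r<m = begin
    at (σ m a ++ σ* m w) (r + (m + q * m))
      ≡⟨ cong (at (σ m a ++ σ* m w)) index ⟩
    at (σ m a ++ σ* m w) (length (σ m a) + (r + q * m))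
      ≡⟨ at-++ʳ (σ m a) (σ* m w) (r + q * m) ⟩
    at (σ* m w) (r + q * m)
      ≡⟨ at-σ* w q r q< r<m ⟩
    (at w q + r) % m ∎
    where
    index : r + (m + q * m) ≡ length (σ m a) + (r + q * m)
    index rewrite length-σ a = trans (sym (+-assoc r m _)) (trans (cong (_+ q * m) (+-comm r m)) (+-assoc m r _))

  at-σ^-suc : ∀ j x → x < m ^ suc j → at (σ^[ suc j ] m) x ≡ (at (σ^[ j ] m) (x / m) + x % m) % m
  at-σ^-suc j x x< = trans (cong (at (σ^[ suc j ] m)) (m≡m%n+[m/n]*n x m))
    (at-σ* (σ^[ j ] m) (x / m) (x % m) (subst (x / m <_) (sym (length-σ^ j)) (m<n*o⇒m/o<n (subst (x <_) (*-comm m (m ^ j)) x<))) (m%n<n x m))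

  at-σ^-0 : ∀ j → at (σ^[ j ] m) 0 ≡ 0
  at-σ^-0 zero    = refl
  at-σ^-0 (suc j) = begin
    at (σ^[ suc j ] m) 0                    ≡⟨ at-σ^-suc j 0 (m^n>0 m (suc j)) ⟩
    (at (σ^[ j ] m) (0 / m) + 0 % m) % m    ≡⟨ cong₂ (λ x y → (at (σ^[ j ] m) x + y) % m) (0/n≡0 m) (m<n⇒m%n≡m (>-nonZero⁻¹ m)) ⟩
    (at (σ^[ j ] m) 0 + 0) % m              ≡⟨ cong (λ x → (x + 0) % m) (at-σ^-0 j) ⟩
    0 % m                                   ≡⟨ m<n⇒m%n≡m (>-nonZero⁻¹ m) ⟩
    0                                       ∎

  at-σ^-stable : ∀ j j′ x → x < m ^ j → x < m ^ j′ → at (σ^[ j ] m) x ≡ at (σ^[ j′ ] m) x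
  at-σ^-stable zero    j′      zero x< x<′ = sym (at-σ^-0 j′)
  at-σ^-stable zero    j′      (suc x) (s<s ()) x<′
  at-σ^-stable (suc j) zero    zero x< x<′ = at-σ^-0 (suc j)
  at-σ^-stable (suc j) zero    (suc x) x< (s<s ())
  at-σ^-stable (suc j) (suc j′) x x< x<′ = begin
    at (σ^[ suc j ] m) x                       ≡⟨ at-σ^-suc j x x< ⟩
    (at (σ^[ j ] m) (x / m) + x % m) % m       ≡⟨ cong (λ y → (y + x % m) % m) (at-σ^-stable j j′ (x / m) (quot j x<) (quot j′ x<′)) ⟩
    (at (σ^[ j′ ] m) (x / m) + x % m) % m      ≡⟨ at-σ^-suc j′ x x<′ ⟨
    at (σ^[ suc j′ ] m) x                      ∎
    where
    quot : ∀ j → x < m ^ suc j → x / m < m ^ j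
    quot j x< = m<n*o⇒m/o<n (subst (x <_) (*-comm m (m ^ j)) x<)

  module _ (2≤m : 2 ≤ m) where

    n<m^n : ∀ n → n < m ^ n
    n<m^n zero    = z<s
    n<m^n (suc n) = ≤-trans (s≤s (n<m^n n)) (≤-trans (+-monoʳ-≤ 1 (≤-reflexive (sym (+-identityʳ (m ^ n)))))
      (≤-trans (+-monoˡ-≤ (m ^ n + 0) (m^n>0 m n)) (*-monoˡ-≤ (m ^ n) 2≤m)))

    t≡blk+offset : ∀ x → t m x ≡ (t m (x / m) + x % m) % m
    t≡blk+offset x = trans (at-σ^-suc x x (<-trans (n<m^n x) (^-monoʳ-< m 2≤m (n<1+n x))))
      (cong (λ y → (y + x % m) % m) (at-σ^-stable x (suc (x / m)) (x / m)
        (≤-<-trans (m/n≤m x m) (n<m^n x)) (<-trans (n<1+n _) (n<m^n (suc (x / m))))))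

    open DigitWord m (t m) t≡blk+offset

    word : ℕ → ℕ → List ℕ
    word x n = applyUpTo (λ j → t m (x + j)) n

    factorAt≡word : ∀ x n → factorAt m x n ≡ word x n
    factorAt≡word x n = map-upTo (λ j → t m (x + j)) n

    length-word : ∀ x n → length (word x n) ≡ n
    length-word x n = length-applyUpTo (λ j → t m (x + j)) n

    word-IsFactor : ∀ x n → IsFactor m (word x n)
    word-IsFactor x n = x , trans (cong (word x) (sym (length-word x n))) (sym (factorAt≡word x (length (word x n))))

    BinEq⇒Moments : ∀ {k n A B} → BinEq m k (word A n) (word B n) → Moments k n A B
    BinEq⇒Moments {k} {n} {A} {B} eq a a<m j j<k = begin
      S n (λ i → C i j *ᶻ D A B a i)
        ≡⟨ S-cong n (λ i _ → lem (C i j) (δ (t m (A + i)) a) (δ (t m (B + i)) a)) ⟩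
      S n (λ i → C i j *ᶻ δ (t m (A + i)) a -ᶻ C i j *ᶻ δ (t m (B + i)) a)
        ≡⟨ S-- n (λ i → C i j *ᶻ δ (t m (A + i)) a) (λ i → C i j *ᶻ δ (t m (B + i)) a) ⟩
      S n (λ i → C i j *ᶻ δ (t m (A + i)) a) -ᶻ S n (λ i → C i j *ᶻ δ (t m (B + i)) a)
        ≡⟨ cong₂ _-ᶻ_ (moment-word A) (moment-word B) ⟨
      moment m (word A n) a j -ᶻ moment m (word B n) a j
        ≡⟨ ℤₚ.i≡j⇒i-j≡0 (BinEq⇒moment≡ m {u = word A n} {v = word B n} eq a j a<m j<k) ⟩
      0ℤ ∎
      where
      lem : ∀ c x y → c *ᶻ (x -ᶻ y) ≡ c *ᶻ x -ᶻ c *ᶻ y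
      lem = solve-∀
      moment-word : ∀ A → moment m (word A n) a j ≡ S n (λ i → C i j *ᶻ δ (t m (A + i)) a)
      moment-word A = moment-applyUpTo m (λ i → t m (A + i)) (λ i → τ<m (A + i)) n a j

    short-factors-separated : ∀ K u v → IsFactor m u → IsFactor m v → length u ≡ length v →
      length u < 2 * m ^ K → BinEq m (suc K) u v → u ≡ v
    short-factors-separated K u v (A , u≡) (B , v≡) len short eq = begin
      u         ≡⟨ u-word ⟩
      word A n  ≡⟨ applyUpTo-cong n (determined K n A B short (BinEq⇒Moments {suc K} {n} {A} {B} (subst₂ (BinEq m (suc K)) u-word v-word eq))) ⟩
      word B n  ≡⟨ v-word ⟨
      v         ∎
      where
      n : ℕ
      n = length u
      u-word : u ≡ word A n
      u-word = trans u≡ (factorAt≡word A n)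
      v-word : v ≡ word B n
      v-word = trans v≡ (trans (factorAt≡word B (length v)) (cong (word B) (sym len)))

    concatMap-σ^-word : ∀ K x n → concatMap (σ^ m K) (word x n) ≡ word (x * m ^ K) (n * m ^ K)
    concatMap-σ^-word zero    x n rewrite *-identityʳ x | *-identityʳ n = concatMap-pure (word x n)
    concatMap-σ^-word (suc K) x n = begin
      concatMap (σ^ m (suc K)) (word x n)      ≡⟨ concatMap-σ^-suc m K (word x n) ⟩
      concatMap (σ^ m K) (σ* m (word x n))     ≡⟨ cong (concatMap (σ^ m K)) (σ*-applyUpTo m n _ (λ j → t m (x * m + j)) digit) ⟩
      concatMap (σ^ m K) (word (x * m) (n * m)) ≡⟨ concatMap-σ^-word K (x * m) (n * m) ⟩
      word (x * m * m ^ K) (n * m * m ^ K)     ≡⟨ cong₂ word (*-assoc x m (m ^ K)) (*-assoc n m (m ^ K)) ⟩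
      word (x * m ^ suc K) (n * m ^ suc K)     ∎
      where
      digit : ∀ q r → r < m → t m (x * m + (r + q * m)) ≡ (t m (x + q) + r) % m
      digit q r r<m = trans (cong (t m) (regroup x m q r)) (τ-digit (x + q) r<m)
        where
        regroup : ∀ x m q r → x * m + (r + q * m) ≡ r + (x + q) * m
        regroup = ℕ-Solver.solve-∀

    t-0 : t m 0 ≡ 0
    t-0 = at-σ^-0 1

    t-*m : ∀ x → t m (x * m) ≡ t m x
    t-*m x = trans (τ-digit x (>-nonZero⁻¹ m)) (trans (cong (_% m) (+-identityʳ (t m x))) (m<n⇒m%n≡m (τ<m x)))

    t-*m^ : ∀ K x → t m (x * m ^ K) ≡ t m x
    t-*m^ zero    x = cong (t m) (*-identityʳ x)
    t-*m^ (suc K) x = trans (cong (t m) (sym (*-assoc x m (m ^ K)))) (trans (t-*m^ K (x * m)) (t-*m x))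

    t-1 : t m 1 ≡ 1
    t-1 = trans (τ-digit 0 2≤m) (trans (cong (λ c → (c + 1) % m) t-0) (m<n⇒m%n≡m 2≤m))

    word-1-2 : word (1 * m) 2 ≡ 1 ∷ 2 % m ∷ []
    word-1-2 = cong₂ (λ a b → a ∷ b ∷ [])
      (trans (cong (t m) (+-identityʳ (1 * m))) (trans (t-*m 1) t-1))
      (trans (cong (t m) (+-comm (1 * m) 1)) (trans (τ-digit 1 2≤m) (cong (λ c → (c + 1) % m) t-1)))

    -- Passing from the boundary after position y to the boundary between the images of the two letters decrements the left letter.
    boundary : ∀ d → ∃ λ y → (t m y + d) % m ≡ 0 × t m (suc y) ≡ 1
    boundary zero    = 0 , trans (cong (λ c → (c + 0) % m) t-0) (m<n⇒m%n≡m (>-nonZero⁻¹ m)) , t-1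
    boundary (suc d) with y , left , right ← boundary d = pred m + y * m , (begin
        (t m (pred m + y * m) + suc d) % m     ≡⟨ cong (λ c → (c + suc d) % m) (τ-digit y (pred-n<n m)) ⟩
        ((t m y + pred m) % m + suc d) % m     ≡⟨ %-+ˡ m (t m y + pred m) (suc d) ⟩
        (t m y + pred m + suc d) % m           ≡⟨ cong (_% m) (regroup (t m y) (pred m) d) ⟩
        (t m y + d + suc (pred m)) % m         ≡⟨ cong (λ x → (t m y + d + x) % m) (suc-pred m) ⟩
        (t m y + d + m) % m                    ≡⟨ [m+n]%n≡m%n (t m y + d) m ⟩
        (t m y + d) % m                        ≡⟨ left ⟩
        0                                      ∎) ,
      trans (cong (λ x → t m (x + y * m)) (suc-pred m)) (trans (t-*m (suc y)) right)
      where
      regroup : ∀ c p d → c + p + suc d ≡ c + d + suc p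
      regroup = ℕ-Solver.solve-∀
      pred-n<n : ∀ n .{{_ : NonZero n}} → pred n < n
      pred-n<n (suc n) = n<1+n n

    word-2-1 : ∃ λ y → word y 2 ≡ 2 % m ∷ 1 ∷ []
    word-2-1 with y , left , right ← boundary (m ∸ 2) = y , cong₂ (λ a b → a ∷ b ∷ [])
      (trans (cong (t m) (+-identityʳ y)) (begin
        t m y                                  ≡⟨ m<n⇒m%n≡m (τ<m y) ⟨
        t m y % m                              ≡⟨ [m+n]%n≡m%n (t m y) m ⟨
        (t m y + m) % m                        ≡⟨ cong (λ x → (t m y + x) % m) (m∸n+n≡m 2≤m) ⟨
        (t m y + (m ∸ 2 + 2)) % m              ≡⟨ cong (_% m) (+-assoc (t m y) (m ∸ 2) 2) ⟨
        (t m y + (m ∸ 2) + 2) % m              ≡⟨ %-+ˡ m (t m y + (m ∸ 2)) 2 ⟨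
        ((t m y + (m ∸ 2)) % m + 2) % m        ≡⟨ cong (λ c → (c + 2) % m) left ⟩
        2 % m                                  ∎))
      (trans (cong (t m) (+-comm y 1)) right)

    1≢2%m : 1 ≢ 2 % m
    1≢2%m eq = 0≢1+n (%-cancelˡ-+ m 1 (>-nonZero⁻¹ m) 2≤m (trans (m<n⇒m%n≡m 2≤m) eq))

    equivalent-pair : ∀ K → ∃ λ u → ∃ λ v → IsFactor m u × IsFactor m v × length u ≡ 2 * m ^ K
      × length v ≡ 2 * m ^ K × ¬ (u ≡ v) × BinEq m (suc K) u v
    equivalent-pair K with y , eq-y ← word-2-1 =
      word (x * m ^ K) n , word (y * m ^ K) n , word-IsFactor (x * m ^ K) n , word-IsFactor (y * m ^ K) n ,
      length-word (x * m ^ K) n , length-word (y * m ^ K) n ,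
      (λ eq → 1≢2%m (begin
        1                              ≡⟨ at-head x word-1-2 ⟨
        t m (x + 0)                    ≡⟨ first-letter x ⟨
        at (word (x * m ^ K) n) 0      ≡⟨ cong (λ u → at u 0) eq ⟩
        at (word (y * m ^ K) n) 0      ≡⟨ first-letter y ⟩
        t m (y + 0)                    ≡⟨ at-head y eq-y ⟩
        2 % m                          ∎)) ,
      subst₂ (BinEq m (suc K))
        (trans (cong (concatMap (σ^ m K)) (sym word-1-2)) (concatMap-σ^-word K x 2))
        (trans (cong (concatMap (σ^ m K)) (sym eq-y)) (concatMap-σ^-word K y 2))
        (concatMap-↭ m (σ^ m K) (σ^-BinEq m K) {1 ∷ 2 % m ∷ []} (swap 1 (2 % m) refl))
      where
      x n : ℕ
      x = 1 * m
      n = 2 * m ^ K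
      at-head : ∀ z {a b} → word z 2 ≡ a ∷ b ∷ [] → t m (z + 0) ≡ a
      at-head z eq = cong (λ u → at u 0) eq
      at-applyUpTo-0 : ∀ (f : ℕ → ℕ) {n} → 0 < n → at (applyUpTo f n) 0 ≡ f 0
      at-applyUpTo-0 f {suc n} _ = refl
      first-letter : ∀ z → at (word (z * m ^ K) n) 0 ≡ t m (z + 0)
      first-letter z = trans (at-applyUpTo-0 (λ j → t m (z * m ^ K + j)) (≤-trans (m^n>0 m K) (m≤m+n (m ^ K) _)))
        (trans (cong (t m) (+-identityʳ (z * m ^ K))) (trans (t-*m^ K z) (cong (t m) (sym (+-identityʳ z)))))

theorem1p11 : (m k : ℕ) → .{{_ : NonZero m}} → 2 ≤ m → 2 ≤ k →
    (∃ λ u → ∃ λ v → IsFactor m u × IsFactor m v × length u ≡ 2 * m ^ (k ∸ 1)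
    × length v ≡ 2 * m ^ (k ∸ 1) × ¬ (u ≡ v) × BinEq m k u v)
    × ((u v : List ℕ) → IsFactor m u → IsFactor m v → length u ≡ length v
    → length u < 2 * m ^ (k ∸ 1) → BinEq m k u v → u ≡ v)
theorem1p11 m (suc K) 2≤m _ = equivalent-pair m 2≤m K , short-factors-separated m 2≤m K
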